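{- Assume $V=L$. The set $\mathrm{IPS}=\bigcup_{\xi\in\Xi}\mathrm{IPS}_\xi$, ordered by $\preceq$, has the Fusion property: for every sequence $\langle\mathcal Y_k:k<\omega\rangle$ of sets $\mathcal Y_k\subseteq\mathrm{IPS}$ each dense in $(\mathrm{IPS},\preceq)$, the set $\{X\in\mathrm{IPS}:\forall k\,(X\sqsubseteq_{\mathrm{fd}}\textstyle\bigcup\mathcal Y_k)\}$ is dense in $(\mathrm{IPS},\preceq)$.
   Context: $T$ is the set of all nonempty finite sequences of countable ordinals, ordered by strict extension $\subset$. $\Xi$ is the set of all at most countable $\xi\subseteq T$ closed downward under $\subset$. $D=2^\omega$; $D^\xi$ is the product of $\xi$ copies of $D$ with the product topology ($D^\varnothing=\{\varnothing\}$). For $\eta\subseteq\xi$: $X\restriction\eta=\{x\restriction\eta:x\in X\}$, and for $Y\subseteq D^\eta$, $Y\uparrow\xi=\{x\in D^\xi:x\restriction\eta\in Y\}$. For $\zeta\in\Xi$, $\mathrm{IPS}_\zeta$ is the set of all $X\subseteq D^\zeta$ for which there is a homeomorphism $H$ of $D^\zeta$ onto $X$ such that for all $x_0,x_1\in D^\zeta$ and all $\eta\in\Xi$, $\eta\subseteq\zeta$: $x_0\restriction\eta=x_1\restriction\eta\iff H(x_0)\restriction\eta=H(x_1)\restriction\eta$; for $X\in\mathrm{IPS}_\zeta$ write $\dim X=\zeta$. For $X,Y\in\mathrm{IPS}$: $X\preceq Y$ iff $\eta=\dim Y\subseteq\dim X$ and $X\restriction\eta\subseteq Y$. A set $\mathcal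 Y\subseteq\mathrm{IPS}$ is dense if for every $X\in\mathrm{IPS}$ there is $Y\in\mathcal Y$ with $Y\preceq X$. For $X\in\mathrm{IPS}$ with $\xi=\dim X$ and $\mathcal Y\subseteq\mathrm{IPS}$, $X\sqsubseteq_{\mathrm{fd}}\bigcup\mathcal Y$ means: there is a finite $\mathcal Y'\subseteq\mathcal Y$ such that $\dim Y\subseteq\xi$ for all $Y\in\mathcal Y'$, $X\subseteq\bigcup_{Y\in\mathcal Y'}(Y\uparrow\xi)$, and $(Y\uparrow\xi)\cap(Z\uparrow\xi)=\varnothing$ for all distinct $Y,Z\in\mathcal Y'$. -}

module Defs where

open import Data.Bool.Base using (Bool)
open import Data.Fin.Base using (Fin)
open import Data.List.Base using (List)
open import Data.List.Membership.Propositional using () renaming (_∈_ to _∈ₗ_)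
open import Data.List.NonEmpty.Base using (List⁺; toList; _⁺++⁺_)
open import Data.List.Relation.Binary.Pointwise using () renaming (setoid to Pointwise-setoid)
open import Data.List.Relation.Unary.All using (All)
open import Data.Nat.Base using (ℕ; suc)
open import Data.Product.Base using (Σ; Σ-syntax; ∃; _×_; _,_; proj₁; proj₂)
open import Data.Sum.Base using (_⊎_)
open import Data.Vec.Base using (Vec; _∷_; lookup)
open import Function.Base using (_∘_)
open import Function.Bundles using (Func; Injection; Inverse; _⇔_; _⟨$⟩_)
open import Function.Relation.Binary.Setoid.Equality using (_⇨_)
open import Level using (Level; 0ℓ; _⊔_) renaming (suc to lsuc)
open import Relation.Binary.Bundles using (Setoid)
open import Relation.Binary.Definitions using (_Respects_)
open import Relation.Binary.PropositionalEquality.Properties using () renaming (setoid to ≡-setoid)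
open import Relation.Nullary.Negation.Core using (¬_)
open import Relation.Unary using (Pred; _∈_; _⊆_; _⊥_)
import Relation.Binary.Construct.On as On

private
  variable
    c ℓ o p c′ ℓ′ o′ : Level

1ℓ 2ℓ : Level
1ℓ = lsuc 0ℓ
2ℓ = lsuc 1ℓ

Subsetoid : (S : Setoid c ℓ) → Pred (Setoid.Carrier S) p → Setoid (c ⊔ p) ℓ
Subsetoid S P = On.setoid S (proj₁ {B = P})

Countable : Setoid c ℓ → Set (c ⊔ ℓ)
Countable S = Injection S (≡-setoid ℕ)

-- The universe of sets: well-founded trees up to bisimilarity.
-- Together with excluded middle for types this is a model of ZFC; the
-- axiom V = L and the countable ordinals below both refer to it.

data V : Set₁ where
  sup : (A : Set) → (A → V) → V

Index : V → Set
Index (sup A _) = A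

element : (x : V) → Index x → V
element (sup _ f) = f

infix 4 _≈ⱽ_ _∈ⱽ_

_≈ⱽ_ : V → V → Set
sup A f ≈ⱽ sup B g =
  (∀ a → ∃ λ b → f a ≈ⱽ g b) × (∀ b → ∃ λ a → f a ≈ⱽ g b)

_∈ⱽ_ : V → V → Set
x ∈ⱽ y = ∃ λ (i : Index y) → x ≈ⱽ element y i

≈ⱽ-refl : ∀ x → x ≈ⱽ x
≈ⱽ-refl (sup A f) = (λ a → a , ≈ⱽ-refl (f a)) , (λ a → a , ≈ⱽ-refl (f a))

≈ⱽ-sym : ∀ x y → x ≈ⱽ y → y ≈ⱽ x
≈ⱽ-sym (sup A f) (sup B g) (l , r) =
  (λ b → proj₁ (r b) , ≈ⱽ-sym _ _ (proj₂ (r b))) ,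
  (λ a → proj₁ (l a) , ≈ⱽ-sym _ _ (proj₂ (l a)))

≈ⱽ-trans : ∀ x y z → x ≈ⱽ y → y ≈ⱽ z → x ≈ⱽ z
≈ⱽ-trans (sup A f) (sup B g) (sup C h) (l , r) (l′ , r′) =
  (λ a → let b , p = l a ; k , q = l′ b in k , ≈ⱽ-trans _ _ _ p q) ,
  (λ k → let b , q = r′ k ; a , p = r b in a , ≈ⱽ-trans _ _ _ p q)

V-setoid : Setoid 1ℓ 0ℓ
V-setoid = record
  { Carrier       = V
  ; _≈_           = _≈ⱽ_
  ; isEquivalence = record
    { refl  = λ {x} → ≈ⱽ-refl x
    ; sym   = λ {x} {y} → ≈ⱽ-sym x y
    ; trans = λ {x} {y} {z} → ≈ⱽ-trans x y z
    }
  }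

-- Von Neumann ordinals: transitive sets linearly ordered by membership
-- (V is well-founded by construction).
record IsOrdinal (α : V) : Set₁ where
  field
    transitive : ∀ {x y} → x ∈ⱽ y → y ∈ⱽ α → x ∈ⱽ α
    comparable : ∀ {x y} → x ∈ⱽ α → y ∈ⱽ α → x ∈ⱽ y ⊎ x ≈ⱽ y ⊎ y ∈ⱽ x

-- First-order formulas of set theory in n free variables (de Bruijn).
data Formula : ℕ → Set where
  _∈′_ _≈′_ : ∀ {n} → Fin n → Fin n → Formula n
  ¬′_       : ∀ {n} → Formula n → Formula n
  _∧′_      : ∀ {n} → Formula n → Formula n → Formula n
  ∃′_       : ∀ {n} → Formula (suc n) → Formula n

_⊨_[_] : (M : V) → ∀ {n} → Formula n → Vec (Index M) n → Set
M ⊨ (i ∈′ j) [ ρ ] = element M (lookup ρ i) ∈ⱽ element M (lookup ρ j)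
M ⊨ (i ≈′ j) [ ρ ] = element M (lookup ρ i) ≈ⱽ element M (lookup ρ j)
M ⊨ (¬′ φ)   [ ρ ] = ¬ (M ⊨ φ [ ρ ])
M ⊨ (φ ∧′ ψ) [ ρ ] = (M ⊨ φ [ ρ ]) × (M ⊨ ψ [ ρ ])
M ⊨ (∃′ φ)   [ ρ ] = ∃ λ a → M ⊨ φ [ a ∷ ρ ]

-- The set of subsets of M first-order definable over (M , ∈) with
-- parameters; variable 0 ranges over the candidate members.
Def : V → V
Def M = sup (Σ[ n ∈ ℕ ] Formula (suc n) × Vec (Index M) n) λ (n , φ , ρ) →
        sup (∃ λ a → M ⊨ φ [ a ∷ ρ ]) (element M ∘ proj₁)

-- L α = ⋃ { Def (L β) : β ∈ α }.
L : V → V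
L (sup A f) = sup (Σ[ a ∈ A ] Index (Def (L (f a)))) λ (a , i) →
              element (Def (L (f a))) i

V=L : Set₁
V=L = ∀ x → ∃ λ α → IsOrdinal α × x ∈ⱽ L α

CountableOrdinal : Setoid 1ℓ 0ℓ
CountableOrdinal = Subsetoid V-setoid λ α →
  IsOrdinal α × Countable (Subsetoid V-setoid (_∈ⱽ α))

T-setoid : Setoid 1ℓ 1ℓ
T-setoid = On.setoid (Pointwise-setoid CountableOrdinal) toList

open Setoid T-setoid public using () renaming (Carrier to T; _≈_ to _≈ᵀ_)

infix 4 _⊂_

_⊂_ : T → T → Set₁
s ⊂ t = ∃ λ r → s ⁺++⁺ r ≈ᵀ t

record Ξ : Set₂ where
  field
    nodes     : Pred T 1ℓ
    respects  : nodes Respects _≈ᵀ_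
    countable : Countable (Subsetoid T-setoid nodes)
    closed    : ∀ {s t} → s ⊂ t → t ∈ nodes → s ∈ nodes

  setoid : Setoid 1ℓ 1ℓ
  setoid = Subsetoid T-setoid nodes

open Ξ using (nodes)

infix 4 _⊆ᶻ_

record _⊆ᶻ_ (η ζ : Ξ) : Set₁ where
  constructor incl
  field
    include : nodes η ⊆ nodes ζ

open _⊆ᶻ_ using (include)

-- No topological axioms are recorded: only discrete spaces, powers and
-- subspaces of these occur.

record Space c ℓ o : Set (lsuc (c ⊔ ℓ ⊔ o) ⊔ 2ℓ) where
  field
    setoid : Setoid c ℓ
  open Setoid setoid public using (Carrier)
  field
    IsOpen : Pred (Pred Carrier 1ℓ) o

Discrete : Setoid c ℓ → Space c ℓ (c ⊔ ℓ ⊔ 1ℓ)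
Discrete S = record
  { setoid = S
  ; IsOpen = _Respects (Setoid._≈_ S)
  }

-- Product topology: U is open if around each x ∈ U it contains a finite
-- intersection of sets { y : y i ∈ O }, O open in X.
infixr 8 _^_

_^_ : Space c ℓ o → Setoid c′ ℓ′ → Space (c ⊔ ℓ ⊔ c′ ⊔ ℓ′) (ℓ ⊔ c′) (c ⊔ ℓ ⊔ c′ ⊔ ℓ′ ⊔ o ⊔ 2ℓ)
X ^ I = record
  { setoid = I ⇨ X.setoid
  ; IsOpen = λ U → ∀ x → x ∈ U →
      Σ[ C ∈ List (Setoid.Carrier I × Pred X.Carrier 1ℓ) ]
        All (λ (i , O) → X.IsOpen O × x ⟨$⟩ i ∈ O) C ×
        (∀ y → All (λ (i , O) → y ⟨$⟩ i ∈ O) C → y ∈ U)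
  }
  where module X = Space X

Subspace : (X : Space c ℓ o) → Pred (Space.Carrier X) 1ℓ → Space (c ⊔ 1ℓ) ℓ (c ⊔ o ⊔ 2ℓ)
Subspace X A = record
  { setoid = Subsetoid X.setoid A
  ; IsOpen = λ W → Σ[ U ∈ Pred X.Carrier 1ℓ ] X.IsOpen U × (∀ x → x ∈ W ⇔ proj₁ x ∈ U)
  }
  where module X = Space X

Continuous : (X : Space c ℓ o) (Y : Space c′ ℓ′ o′) →
             (Space.Carrier X → Space.Carrier Y) → Set (c′ ⊔ o ⊔ o′ ⊔ 2ℓ)
Continuous X Y f = ∀ U → Space.IsOpen Y U → Space.IsOpen X (U ∘ f)

record Homeomorphism (X : Space c ℓ o) (Y : Space c′ ℓ′ o′) :
                     Set (c ⊔ c′ ⊔ ℓ ⊔ ℓ′ ⊔ o ⊔ o′ ⊔ 2ℓ) where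
  field
    inverse         : Inverse (Space.setoid X) (Space.setoid Y)
    to-continuous   : Continuous X Y (Inverse.to inverse)
    from-continuous : Continuous Y X (Inverse.from inverse)

  open Inverse inverse public using (to)

D : Space 0ℓ 0ℓ 2ℓ
D = Discrete (≡-setoid Bool) ^ ≡-setoid ℕ

D^ : Ξ → Space 1ℓ 1ℓ 2ℓ
D^ ξ = D ^ Ξ.setoid ξ

Point : Ξ → Set₁
Point ξ = Space.Carrier (D^ ξ)

Same : ∀ ξ → Point ξ → Point ξ → Set₁
Same ξ = Setoid._≈_ (Space.setoid (D^ ξ))

infix 4 Same

syntax Same ξ x y = x ≈[ ξ ] y

module _ {η ζ : Ξ} where

  infixl 5 _↾_ _↾[_] _↑[_]

  _↾_ : Point ζ → η ⊆ᶻ ζ → Point η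
  x ↾ η⊆ζ = record
    { to   = λ (t , t∈η) → x ⟨$⟩ (t , include η⊆ζ t∈η)
    ; cong = Func.cong x
    }

  _↾[_] : Pred (Point ζ) 1ℓ → η ⊆ᶻ ζ → Pred (Point η) 1ℓ
  (X ↾[ η⊆ζ ]) y = ∃ λ x → x ∈ X × x ↾ η⊆ζ ≈[ η ] y

  _↑[_] : Pred (Point η) 1ℓ → η ⊆ᶻ ζ → Pred (Point ζ) 1ℓ
  (Y ↑[ η⊆ζ ]) x = x ↾ η⊆ζ ∈ Y

record IPS[_] (ζ : Ξ) (X : Pred (Point ζ) 1ℓ) : Set₂ where
  field
    homeomorphism : Homeomorphism (D^ ζ) (Subspace (D^ ζ) X)

  H : Point ζ → Point ζ
  H = proj₁ ∘ Homeomorphism.to homeomorphism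

  field
    projection-keeping : ∀ x₀ x₁ (η : Ξ) (η⊆ζ : η ⊆ᶻ ζ) →
      x₀ ↾ η⊆ζ ≈[ η ] x₁ ↾ η⊆ζ ⇔ H x₀ ↾ η⊆ζ ≈[ η ] H x₁ ↾ η⊆ζ

record IPS : Set₂ where
  field
    dim      : Ξ
    set      : Pred (Point dim) 1ℓ
    respects : set Respects Same dim
    perfect  : IPS[ dim ] set

open IPS public using (dim; set)

infix 4 _≼_ _≈ᴵ_ _⊑fd⋃_

_≼_ : IPS → IPS → Set₁
X ≼ Y = Σ[ η⊆ξ ∈ dim Y ⊆ᶻ dim X ] set X ↾[ η⊆ξ ] ⊆ set Y

-- Extensional equality: the dimensions have the same nodes, and each set
-- is included in the other along this identification.
_≈ᴵ_ : IPS → IPS → Set₁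
X ≈ᴵ Y = X ≼ Y × Y ≼ X

Dense : Pred IPS 2ℓ → Set₂
Dense 𝒴 = ∀ X → ∃ λ Y → Y ∈ 𝒴 × Y ≼ X

record _⊑fd⋃_ (X : IPS) (𝒴 : Pred IPS 2ℓ) : Set₂ where
  field
    pieces   : List IPS
    chosen   : All (_∈ 𝒴) pieces
    below    : ∀ Y → Y ∈ₗ pieces → dim Y ⊆ᶻ dim X
    covers   : ∀ x → x ∈ set X →
               Σ[ Y ∈ IPS ] Σ[ m ∈ Y ∈ₗ pieces ] x ∈ set Y ↑[ below Y m ]
    disjoint : ∀ Y Z (m : Y ∈ₗ pieces) (n : Z ∈ₗ pieces) → ¬ (Y ≈ᴵ Z) →
               (set Y ↑[ below Y m ]) ⊥ (set Z ↑[ below Z n ])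

{-# OPTIONS --safe #-}
module Submission where

-- Every node of T has only finitely many predecessors, so a projection-keeping
-- homeomorphism is a continuous map whose value at t determines, together with the
-- values below t, the argument at t, and conversely. This lets one argue with
-- self-maps of D^T that are the identity off a countable set.
--
-- Fusion: maps P₀, P₁ = P₀ G₀, P₂ = P₁ G₁, … are built such that G_k preserves a finite
-- window of bits; P_k is uniformly continuous (D^{≤t} is compact), so windows chosen
-- large enough make P_k converge to a map P_∞ which again keeps projections. Given a
-- cell of the k-th window, density yields Y ∈ 𝒴_k inside the P_k-image of the cell, and
-- G_k is redefined on the cell so as to move that image into Y. The cells are finitely
-- many and their images disjoint, so the resulting sets Y are the required pieces.
-- Excluded middle for types, in the form P ⊎ ¬ P, also supplies all choices.

open import Defs
open import Axiom.ExcludedMiddle using (ExcludedMiddle)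
open import Data.Bool.Base using (Bool; true; false)
open import Data.Bool.Properties using (¬-not)
open import Data.Empty using (⊥-elim)
open import Data.Unit.Base using (⊤; tt)
open import Data.List.Base using (List; []; _∷_; _++_; map; upTo; length; filter)
open import Data.List.Membership.Propositional using () renaming (_∈_ to _∈ₗ_)
open import Data.List.Membership.Propositional.Properties
  using (∈-map⁺; ∈-map⁻; ∈-++⁺ˡ; ∈-++⁺ʳ; ∈-++⁻; ∈-upTo⁺; ∈-filter⁺; ∈-filter⁻)
open import Data.List.NonEmpty.Base using (_⁺++⁺_; toList)
open import Data.List.Properties using (++-identityʳ)
open import Data.List.NonEmpty.Properties using (⁺++⁺-assoc)
open import Data.List.Relation.Binary.Pointwise as Pointwise using (Pointwise; []; _∷_; ++⁺; Pointwise-length)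
open import Data.List.Relation.Unary.All as All using (All; []; _∷_)
open import Data.List.Relation.Unary.AllPairs using (AllPairs; []; _∷_)
open import Data.List.Relation.Unary.Any using (here; there)
open import Data.Nat.Base
open import Data.Nat.Properties
open import Data.Product.Base using (Σ; Σ-syntax; ∃; _×_; _,_; proj₁; proj₂)
open import Data.Sum.Base using (_⊎_; inj₁; inj₂; [_,_])
open import Function.Base using (_∘_; id)
open import Function.Bundles using (Func; Injection; _⇔_; mk⇔; Inverse; Equivalence; _⟨$⟩_)
open import Level using (0ℓ; Lift; lift; lower)
open import Relation.Binary.Bundles using (Setoid)
open import Relation.Binary.Definitions using (_Respects_; tri<; tri≈; tri>)
open import Relation.Binary.PropositionalEquality
  using (_≡_; _≢_; refl; sym; trans; cong; subst)
open import Relation.Nullary.Decidable.Core using (Dec; yes; no; decidable-stable)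
open import Relation.Nullary.Negation.Core using (¬_)
open import Relation.Unary using (Pred; _∈_; _⊆_)

-- The prefix order on `T` and the tree of predecessors of a node.

module Tᵉ = Setoid T-setoid

infix 4 _⊑_ _≐_

_⊑_ : T → T → Set₁
s ⊑ t = s ≈ᵀ t ⊎ s ⊂ t

⊑-refl : ∀ {t} → t ⊑ t
⊑-refl {t} = inj₁ (Tᵉ.refl {t})

⊑-trans : ∀ {s t u} → s ⊑ t → t ⊑ u → s ⊑ u
⊑-trans {s} {t} {u} (inj₁ s≈t) (inj₁ t≈u) = inj₁ (Tᵉ.trans {s} {t} {u} s≈t t≈u)
⊑-trans {s} {t} {u} (inj₁ s≈t) (inj₂ (r , e)) = inj₂ (r , Tᵉ.trans {s ⁺++⁺ r} {t ⁺++⁺ r} {u} (++⁺ s≈t (Tᵉ.refl {r})) e)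
⊑-trans {s} {t} {u} (inj₂ (r , e)) (inj₁ t≈u) = inj₂ (r , Tᵉ.trans {s ⁺++⁺ r} {t} {u} e t≈u)
⊑-trans {s} {t} {u} (inj₂ (r , e)) (inj₂ (q , f)) = inj₂
  ( r ⁺++⁺ q
  , subst (_≈ᵀ u) (⁺++⁺-assoc s r q)
      (Tᵉ.trans {(s ⁺++⁺ r) ⁺++⁺ q} {t ⁺++⁺ q} {u} (++⁺ e (Tᵉ.refl {q})) f))

⊑-closed : ∀ (ζ : Ξ) {s t} → s ⊑ t → Ξ.nodes ζ t → Ξ.nodes ζ s
⊑-closed ζ {s} {t} (inj₁ s≈t) t∈ζ = Ξ.respects ζ (Tᵉ.sym {s} {t} s≈t) t∈ζ
⊑-closed ζ (inj₂ s⊂t) t∈ζ = Ξ.closed ζ s⊂t t∈ζ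

++-cancel-length : ∀ {a r} {A : Set a} {R : A → A → Set r} xs ys {us vs} → length xs ≡ length ys →
                   Pointwise R (xs ++ us) (ys ++ vs) → Pointwise R xs ys
++-cancel-length []       []       _ _        = []
++-cancel-length (_ ∷ xs) (_ ∷ ys) e (p ∷ ps) = p ∷ ++-cancel-length xs ys (suc-injective e) ps

⊑-prefix : ∀ {s t} → s ⊑ t → ∃ λ us → Pointwise (Setoid._≈_ CountableOrdinal) (toList s ++ us) (toList t)
⊑-prefix {s} {t} (inj₁ s≈t) = [] ,
  subst (λ l → Pointwise (Setoid._≈_ CountableOrdinal) l (toList t)) (sym (++-identityʳ (toList s))) s≈t
⊑-prefix (inj₂ (r , e)) = toList r , e

-- Predecessors of `t` are prefixes of one sequence, so two of the same length coincide: the length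
-- codes them injectively.
down : T → Ξ
down t = record
  { nodes     = _⊑ t
  ; respects  = λ {s} {s′} s≈s′ s⊑t → ⊑-trans {s′} {s} {t} (inj₁ (Tᵉ.sym {s} {s′} s≈s′)) s⊑t
  ; countable = record
    { to        = λ (s , _) → length (toList s)
    ; cong      = λ {(s , _)} {(s′ , _)} s≈s′ → Pointwise-length s≈s′
    ; injective = λ {(s , s⊑t)} {(s′ , s′⊑t)} e →
        let us , p = ⊑-prefix {s} {t} s⊑t ; us′ , p′ = ⊑-prefix {s′} {t} s′⊑t in
        ++-cancel-length (toList s) (toList s′) e
          (Pointwise.transitive (λ {α} {β} {γ} → Setoid.trans CountableOrdinal {α} {β} {γ}) p
            (Pointwise.symmetric (λ {α} {β} → Setoid.sym CountableOrdinal {α} {β}) p′))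
    }
  ; closed    = λ {s} {s′} s⊂s′ s′⊑t → ⊑-trans {s} {s′} {t} (inj₂ s⊂s′) s′⊑t
  }

-- Points of D^T and their projection-keeping self-maps.

Bit : Set₁
Bit = T × ℕ

-- Points of D^ξ are represented by their extensions to all of T.
record Pt : Set₁ where
  field
    at      : T → ℕ → Bool
    at-cong : ∀ {s t} → s ≈ᵀ t → ∀ i → at s i ≡ at t i

open Pt

_≐_ : Pt → Pt → Set₁
x ≐ y = ∀ t i → at x t i ≡ at y t i

_≡[_]_ : Pt → List Bit → Pt → Set₁
x ≡[ C ] y = ∀ {t i} → (t , i) ∈ₗ C → at x t i ≡ at y t i

_≡≤[_]_ : Pt → T → Pt → Set₁
x ≡≤[ t ] y = ∀ {s} → s ⊑ t → ∀ i → at x s i ≡ at y s i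

-- Projections to the sets `down t` suffice, since a downward closed set is the union of the
-- `down t` of its nodes. Continuity is stated one output bit at a time, each being decided near `x`
-- by finitely many input bits.
record Keeping : Set₁ where
  field
    fun   : Pt → Pt
    keep→ : ∀ t {x y} → x ≡≤[ t ] y → fun x ≡≤[ t ] fun y
    keep← : ∀ t {x y} → fun x ≡≤[ t ] fun y → x ≡≤[ t ] y
    cont  : ∀ x t i → ∃ λ C → ∀ y → x ≡[ C ] y → at (fun x) t i ≡ at (fun y) t i

  fun-cong : ∀ {x y} → x ≐ y → fun x ≐ fun y
  fun-cong x≐y t = keep→ t (λ {s} _ → x≐y s) (⊑-refl {t})

  fun-injective : ∀ {x y} → fun x ≐ fun y → x ≐ y
  fun-injective e t = keep← t (λ {s} _ → e s) (⊑-refl {t})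

  cont-list : ∀ x B → ∃ λ C → ∀ y → x ≡[ C ] y → fun x ≡[ B ] fun y
  cont-list x [] = [] , λ _ _ ()
  cont-list x ((t , i) ∷ B) = let C , c = cont x t i ; C′ , c′ = cont-list x B in
    C ++ C′ , λ where
      y e (here refl) → c y (λ m → e (∈-++⁺ˡ m))
      y e (there m)   → c′ y (λ m → e (∈-++⁺ʳ C m)) m

open Keeping

idᴷ : Keeping
idᴷ = record
  { fun   = id
  ; keep→ = λ _ e → e
  ; keep← = λ _ e → e
  ; cont  = λ x t i → (t , i) ∷ [] , λ y e → e (here refl)
  }

_∘ᴷ_ : Keeping → Keeping → Keeping
F ∘ᴷ G = record
  { fun   = fun F ∘ fun G
  ; keep→ = λ t e → keep→ F t (keep→ G t e)
  ; keep← = λ t e → keep← G t (keep← F t e)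
  ; cont  = λ x t i → let B , b = cont F (fun G x) t i ; C , c = cont-list G x B in
              C , λ y e → b (fun G y) (c y e)
  }

-- Maps for different dimensions act on the same points and are told apart by their support, so they
-- compose without liftings.
Supported : Ξ → Keeping → Set₁
Supported ζ F = ∀ {t} → ¬ Ξ.nodes ζ t → ∀ x i → at (fun F x) t i ≡ at x t i

-- Exhausting the bits of a countable set of nodes by finite lists.

record Enumeration (A : Pred T 1ℓ) : Set₁ where
  field
    -- Increasing finite stages: agreement on later and later stages describes the neighbourhoods of
    -- a point restricted to `A`, and two enumerations can be joined stage by stage.
    bits       : ℕ → List Bit
    monotone   : ∀ {j k b} → j ≤ k → b ∈ₗ bits j → b ∈ₗ bits k
    inside     : ∀ {k t i} → (t , i) ∈ₗ bits k → A t
    exhaustive : ∀ {t} → A t → ∀ i → ∃ λ k → ∃ λ s → s ≈ᵀ t × (s , i) ∈ₗ bits k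

open Enumeration

-- Each block [s², (s+1)²) contains the codes of the pairs of sum s.
pair : ℕ → ℕ → ℕ
pair m n = (m + n) * (m + n) + m

pair-sum-mono : ∀ m n m′ n′ → m + n < m′ + n′ → pair m n < pair m′ n′
pair-sum-mono m n m′ n′ s<s′ = begin-strict
  s * s + m         ≤⟨ +-monoʳ-≤ (s * s) (m≤m+n m n) ⟩
  s * s + s         ≡⟨ +-comm (s * s) s ⟩
  s + s * s         <⟨ n<1+n _ ⟩
  suc (s + s * s)   ≤⟨ s≤s (+-monoʳ-≤ s (*-monoʳ-≤ s (n≤1+n s))) ⟩
  suc s * suc s     ≤⟨ *-mono-≤ s<s′ s<s′ ⟩
  s′ * s′           ≤⟨ m≤m+n (s′ * s′) m′ ⟩
  s′ * s′ + m′      ∎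
  where
  open ≤-Reasoning
  s = m + n
  s′ = m′ + n′

pair-injective : ∀ {m n m′ n′} → pair m n ≡ pair m′ n′ → m ≡ m′ × n ≡ n′
pair-injective {m} {n} {m′} {n′} e with <-cmp (m + n) (m′ + n′)
... | tri< s<s′ _ _ = ⊥-elim (<⇒≢ (pair-sum-mono m n m′ n′ s<s′) e)
... | tri> _ _ s>s′ = ⊥-elim (<⇒≢ (pair-sum-mono m′ n′ m n s>s′) (sym e))
... | tri≈ _ s≡s′ _ = m≡m′ , +-cancelˡ-≡ m n n′ (trans s≡s′ (cong (_+ n′) (sym m≡m′)))
  where
  m≡m′ = +-cancelˡ-≡ ((m + n) * (m + n)) m m′ (trans e (cong (λ s → s * s + m′) (sym s≡s′)))

enumeration-covers : ∀ {A} (E : Enumeration A) C → (∀ {t i} → (t , i) ∈ₗ C → A t) →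
                     ∃ λ k → ∀ {x y} → x ≡[ bits E k ] y → x ≡[ C ] y
enumeration-covers E [] _ = 0 , λ _ ()
enumeration-covers E ((t , i) ∷ C) C⊆A with exhaustive E (C⊆A (here refl)) i | enumeration-covers E C (C⊆A ∘ there)
... | j , s , s≈t , s∈ | k , covers = j ⊔ k , λ {x} {y} e → agree x y e
  where
  agree : ∀ x y → x ≡[ bits E (j ⊔ k) ] y → x ≡[ (t , i) ∷ C ] y
  agree x y e (here refl) = trans (sym (at-cong x s≈t i)) (trans (e (monotone E (m≤m⊔n j k) s∈)) (at-cong y s≈t i))
  agree x y e (there m)   = covers {x} {y} (e ∘ monotone E (m≤n⊔m j k)) m

-- Consequences of excluded middle: enumerations, splicing and limits of points.

module Classical (em : ∀ {ℓ} → ExcludedMiddle ℓ) where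

  -- Stage `k + 1` adds a bit with code `k`, if there is one. Injectivity of the coding shows that
  -- the node so found is the intended one up to `≈ᵀ`.
  enumerate : ∀ ξ → Enumeration (Ξ.nodes ξ)
  enumerate ξ = record
    { bits       = bitsᵉ
    ; monotone   = λ j≤k → mono (≤⇒≤′ j≤k)
    ; inside     = λ {k} → ins k
    ; exhaustive = exh
    }
    where
    module C = Injection (Ξ.countable ξ)
    Coded : ℕ → Set₁
    Coded k = ∃ λ (t : Σ T (Ξ.nodes ξ)) → ∃ λ i → pair (C.to t) i ≡ k
    bit : ∀ {k} → Dec (Coded k) → List Bit → List Bit
    bit (yes ((t , _) , i , _)) B = (t , i) ∷ B
    bit (no _) B = B
    bitsᵉ : ℕ → List Bit
    bitsᵉ zero = []
    bitsᵉ (suc k) = bit (em {P = Coded k}) (bitsᵉ k)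
    mono : ∀ {j k b} → j ≤′ k → b ∈ₗ bitsᵉ j → b ∈ₗ bitsᵉ k
    mono (≤′-reflexive refl) m = m
    mono {k = suc k} (≤′-step p) m with em {P = Coded k}
    ... | yes _ = there (mono p m)
    ... | no _ = mono p m
    ins : ∀ k {t i} → (t , i) ∈ₗ bitsᵉ k → Ξ.nodes ξ t
    ins (suc k) m with em {P = Coded k}
    ins (suc k) (here refl) | yes ((_ , t∈ξ) , _) = t∈ξ
    ins (suc k) (there m)   | yes _ = ins k m
    ins (suc k) m           | no _ = ins k m
    exh : ∀ {t} → Ξ.nodes ξ t → ∀ i → ∃ λ k → ∃ λ s → s ≈ᵀ t × (s , i) ∈ₗ bitsᵉ k
    exh {t} t∈ξ i with em {P = Coded (pair (C.to (t , t∈ξ)) i)} in eq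
    ... | no ¬c = ⊥-elim (¬c ((t , t∈ξ) , i , refl))
    ... | yes ((s , s∈ξ) , j , e) with pair-injective {C.to (s , s∈ξ)} {j} {C.to (t , t∈ξ)} {i} e
    ... | e₁ , refl = suc (pair (C.to (t , t∈ξ)) i) , s , C.injective {s , s∈ξ} {t , t∈ξ} e₁ ,
                      subst (λ d → (s , i) ∈ₗ bit d (bitsᵉ k)) (sym eq) (here refl)
      where k = pair (C.to (t , t∈ξ)) i

  stable : ∀ {ℓ} {P : Set ℓ} → ¬ ¬ P → P
  stable = decidable-stable em

  counterexample : ∀ {a b} {A : Set a} {B : A → Set b} → ¬ (∀ x → B x) → ∃ λ x → ¬ B x
  counterexample ¬∀ = stable λ ¬∃ → ¬∀ λ x → stable λ ¬b → ¬∃ (x , ¬b)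

  Least : ∀ {a} → Pred ℕ a → Pred ℕ a
  Least P n = P n × (∀ {m} → P m → n ≤ m)

  least : ∀ {a} (P : Pred ℕ a) n → P n → ∃ (Least P)
  least P n p = [ id , (λ none → ⊥-elim (none ≤-refl p)) ] (search (suc n))
    where
    search : ∀ n → ∃ (Least P) ⊎ (∀ {m} → m < n → ¬ P m)
    search zero = inj₂ λ ()
    search (suc n) with search n | em {P = P n}
    ... | inj₁ found | _     = inj₁ found
    ... | inj₂ none  | yes p = inj₁ (n , p , λ q → ≮⇒≥ λ m<n → none m<n q)
    ... | inj₂ none  | no ¬p = inj₂ λ m<1+n q → [ (λ m<n → none m<n q) , (λ { refl → ¬p q }) ] (m<1+n⇒m<n∨m≡n m<1+n)

  splice : ∀ {ℓ} (A : T → ℕ → Set ℓ) → (∀ {s t i} → s ≈ᵀ t → A s i → A t i) → Pt → Pt → Pt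
  splice A A-resp x y = record { at = at′ ; at-cong = at′-cong }
    where
    at′ : T → ℕ → Bool
    at′ t i with em {P = A t i}
    ... | yes _ = at x t i
    ... | no _  = at y t i
    at′-cong : ∀ {s t} → s ≈ᵀ t → ∀ i → at′ s i ≡ at′ t i
    at′-cong {s} {t} s≈t i with em {P = A s i} | em {P = A t i}
    ... | yes _ | yes _ = at-cong x s≈t i
    ... | no _  | no _  = at-cong y s≈t i
    ... | yes p | no ¬p = ⊥-elim (¬p (A-resp s≈t p))
    ... | no ¬p | yes p = ⊥-elim (¬p (A-resp (Tᵉ.sym {s} {t} s≈t) p))

  module _ {ℓ} (A : T → ℕ → Set ℓ) (A-resp : ∀ {s t i} → s ≈ᵀ t → A s i → A t i) where

    splice-in : ∀ x y {t i} → A t i → at (splice A A-resp x y) t i ≡ at x t i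
    splice-in x y {t} {i} p with em {P = A t i}
    ... | yes _ = refl
    ... | no ¬p = ⊥-elim (¬p p)

    splice-out : ∀ x y {t i} → ¬ A t i → at (splice A A-resp x y) t i ≡ at y t i
    splice-out x y {t} {i} ¬p with em {P = A t i}
    ... | yes p = ⊥-elim (¬p p)
    ... | no _  = refl

  abstract
    -- A bit at a node of `A` is read off at a stage that lists it; coherence makes the value
    -- independent of the stage and of the representative node.
    limit : ∀ {A : Pred T 1ℓ} → A Respects _≈ᵀ_ → (E : Enumeration A) (x : ℕ → Pt) →
            (∀ {j k} → j ≤ k → x j ≡[ bits E j ] x k) → (z : Pt) →
            ∃ λ y → (∀ {j k} → j ≤ k → y ≡[ bits E j ] x k) ×
                    (∀ {t} → ¬ A t → ∀ i → at y t i ≡ at z t i)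
    limit {A} A-resp E x coh z = record { at = at′ ; at-cong = at′-cong } , limits , outside
      where
      bits-agree : ∀ {s t i j k} → (s , i) ∈ₗ bits E j → (t , i) ∈ₗ bits E k → s ≈ᵀ t →
                   at (x j) s i ≡ at (x k) t i
      bits-agree {s} {t} {i} {j} {k} s∈ t∈ s≈t =
        trans (coh (m≤m⊔n j k) s∈)
          (trans (at-cong (x (j ⊔ k)) s≈t i) (sym (coh (m≤n⊔m j k) t∈)))
      at′ : T → ℕ → Bool
      at′ t i with em {P = A t}
      ... | yes t∈A = let k , s , _ = exhaustive E t∈A i in at (x k) s i
      ... | no _    = at z t i
      at′-cong : ∀ {s t} → s ≈ᵀ t → ∀ i → at′ s i ≡ at′ t i
      at′-cong {s} {t} s≈t i with em {P = A s} | em {P = A t}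
      ... | no _  | no _  = at-cong z s≈t i
      ... | yes p | no ¬p = ⊥-elim (¬p (A-resp s≈t p))
      ... | no ¬p | yes p = ⊥-elim (¬p (A-resp (Tᵉ.sym {s} {t} s≈t) p))
      ... | yes p | yes q with exhaustive E p i | exhaustive E q i
      ... | j , s′ , s′≈s , s∈ | k , t′ , t′≈t , t∈ = bits-agree s∈ t∈
        (Tᵉ.trans {s′} {t} {t′} (Tᵉ.trans {s′} {s} {t} s′≈s s≈t) (Tᵉ.sym {t′} {t} t′≈t))
      limits : ∀ {j k} → j ≤ k → ∀ {t i} → (t , i) ∈ₗ bits E j → at′ t i ≡ at (x k) t i
      limits {j} {k} j≤k {t} {i} t∈ with em {P = A t}
      ... | no ¬p = ⊥-elim (¬p (inside E t∈))
      ... | yes p with exhaustive E p i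
      ... | m , s , s≈t , s∈ = trans (bits-agree s∈ t∈ s≈t) (coh j≤k t∈)
      outside : ∀ {t} → ¬ A t → ∀ i → at′ t i ≡ at z t i
      outside {t} ¬p i with em {P = A t}
      ... | yes p = ⊥-elim (¬p p)
      ... | no _  = refl

  -- Convergent subsequences and moduli of continuity.

  module _ {a} {I : Set a} (f : ℕ → I → Bool) where

    Infinite : Pred ℕ 0ℓ → Set
    Infinite S = ∀ N → ∃ λ n → N ≤ n × n ∈ S

    ConstantOn : Pred ℕ 0ℓ → I → Set
    ConstantOn S i = ∀ {m n} → m ∈ S → n ∈ S → f m i ≡ f n i

    refine : ∀ S → Infinite S → ∀ is →
             ∃ λ S′ → Infinite S′ × S′ ⊆ S × (∀ {i} → i ∈ₗ is → ConstantOn S′ i)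
    refine S inf [] = S , inf , id , λ ()
    refine S inf (i ∷ is) with refine S inf is
    ... | S′ , inf′ , S′⊆S , const with em {P = Infinite (λ n → n ∈ S′ × f n i ≡ true)}
    ... | yes inf″ = _ , inf″ , S′⊆S ∘ proj₁ , λ where
          (here refl) (_ , p) (_ , q) → trans p (sym q)
          (there m) (p , _) (q , _) → const m p q
    -- If `true` is not taken infinitely often, the bit is `false` on the members of `S′` beyond
    -- some `N`, and these are still infinitely many.
    ... | no ¬inf = let N , none = counterexample ¬inf in
          (λ n → n ∈ S′ × N ≤ n) ,
          (λ M → let n , M⊔N≤n , n∈S′ = inf′ (M ⊔ N) in
             n , m⊔n≤o⇒m≤o M N M⊔N≤n , n∈S′ , m⊔n≤o⇒n≤o M N M⊔N≤n) ,
          S′⊆S ∘ proj₁ , λ where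
            (here refl) (p , N≤m) (q , N≤n) →
              trans (¬-not (λ e → none (_ , N≤m , p , e)))
                    (sym (¬-not (λ e → none (_ , N≤n , q , e))))
            (there m) (p , _) (q , _) → const m p q

    subsequence : (C : ℕ → List I) → ∃ λ (φ : ℕ → ℕ) → (∀ k → k ≤ φ k) ×
                  (∀ {j k} → j ≤ k → ∀ {i} → i ∈ₗ C j → f (φ j) i ≡ f (φ k) i)
    subsequence C = φ , φ-≥ , λ {j} {k} j≤k i∈ →
      proj₂ (proj₂ (proj₂ (refined j))) i∈ (φ-∈ j) (decreasing (≤⇒≤′ j≤k) (φ-∈ k))
      where
      stage : ℕ → ∃ Infinite
      refined : ∀ k → ∃ λ S′ → Infinite S′ × S′ ⊆ proj₁ (stage k) × (∀ {i} → i ∈ₗ C k → ConstantOn S′ i)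
      stage zero    = (λ _ → ⊤) , λ N → N , ≤-refl , tt
      stage (suc k) = let S , inf , _ = refined k in S , inf
      refined k = let S , inf = stage k in refine S inf (C k)
      φ : ℕ → ℕ
      -- The diagonal choice: a member of the `k`-th refined set that is at least `k`; `φ` may
      -- repeat values.
      φ k = proj₁ (proj₁ (proj₂ (refined k)) k)
      φ-≥ : ∀ k → k ≤ φ k
      φ-≥ k = proj₁ (proj₂ (proj₁ (proj₂ (refined k)) k))
      φ-∈ : ∀ k → φ k ∈ proj₁ (refined k)
      φ-∈ k = proj₂ (proj₂ (proj₁ (proj₂ (refined k)) k))
      decreasing : ∀ {j k} → j ≤′ k → proj₁ (refined k) ⊆ proj₁ (refined j)
      decreasing (≤′-reflexive refl) = id
      decreasing {k = suc k} (≤′-step p) = decreasing p ∘ proj₁ (proj₂ (proj₂ (refined (suc k))))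

  local-cont : ∀ F x t i → ∃ λ C → (∀ {s j} → (s , j) ∈ₗ C → s ⊑ t) ×
               (∀ y → x ≡[ C ] y → at (fun F x) t i ≡ at (fun F y) t i)
  local-cont F x t i = C′ , proj₂ ∘ ∈-filter⁻ (λ _ → em) {xs = C} , λ y e →
    trans (C-cont (z y) (λ {s} {j} m → z-agrees y e s j m))
      (keep→ F t {z y} {y}
        (λ {s} p j → splice-in A (λ {s} {s′} {i} → A-resp {s} {s′} {i}) y x {s} {j} p) (⊑-refl {t}) i)
    where
    C = proj₁ (cont F x t i)
    C-cont = proj₂ (cont F x t i)
    C′ = filter {P = λ (s , _) → s ⊑ t} (λ _ → em) C
    A : T → ℕ → Set₁
    A s _ = s ⊑ t
    A-resp : ∀ {s s′ : T} {i : ℕ} → s ≈ᵀ s′ → s ⊑ t → s′ ⊑ t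
    A-resp {s} {s′} = Ξ.respects (down t) {s} {s′}
    z : Pt → Pt
    z y = splice A (λ {s} {s′} {i} → A-resp {s} {s′} {i}) y x
    z-agrees : ∀ y → x ≡[ C′ ] y → ∀ s j → (s , j) ∈ₗ C → at x s j ≡ at (z y) s j
    z-agrees y e s j m with em {P = s ⊑ t}
    ... | yes p = e (∈-filter⁺ (λ _ → em) m p)
    ... | no _  = refl

  -- With `F` the identity this is bitwise convergence on `ξ`. All maps are included because
  -- compactness arguments evaluate several of them along one sequence.
  Converges : Ξ → (ℕ → Pt) → Pt → Set₁
  Converges ξ xs x = ∀ F {t} → Ξ.nodes ξ t → ∀ i →
    ∃ λ k → ∀ {n} → k ≤ n → at (fun F (xs n)) t i ≡ at (fun F x) t i

  converges : ∀ ξ xs x → (∀ {j k} → j ≤ k → x ≡[ bits (enumerate ξ) j ] xs k) → Converges ξ xs x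
  converges ξ xs x lim F {t} t∈ξ i with local-cont F x t i
  ... | C , C⊑t , C-cont
    with enumeration-covers (enumerate ξ) C (λ {s} m → ⊑-closed ξ {s} {t} (C⊑t m) t∈ξ)
  ... | k , covers = k , λ {n} k≤n → sym (C-cont (xs n) (covers {x} {xs n} (lim k≤n)))

  abstract
    -- The bits of both sequences, tagged by `inj₁` and `inj₂`, are thinned out together, so a
    -- single `φ` serves `x` and `y`.
    convergent-subsequence : ∀ ξ (x y : ℕ → Pt) → ∃ λ (φ : ℕ → ℕ) → (∀ k → k ≤ φ k) ×
      ∃ λ x* → ∃ λ y* → Converges ξ (x ∘ φ) x* × Converges ξ (y ∘ φ) y*
    convergent-subsequence ξ x y
      with subsequence f (λ k → map inj₁ (bits (enumerate ξ) k) ++ map inj₂ (bits (enumerate ξ) k))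
      where
      f : ℕ → Bit ⊎ Bit → Bool
      f n (inj₁ (t , i)) = at (x n) t i
      f n (inj₂ (t , i)) = at (y n) t i
    ... | φ , φ-≥ , coherent
      with limit (λ {s} {t} → Ξ.respects ξ {s} {t}) (enumerate ξ) (x ∘ φ)
             (λ j≤k m → coherent j≤k (∈-++⁺ˡ (∈-map⁺ inj₁ m))) (x 0)
         | limit (λ {s} {t} → Ξ.respects ξ {s} {t}) (enumerate ξ) (y ∘ φ)
             (λ {j} j≤k m → coherent j≤k (∈-++⁺ʳ (map inj₁ (bits (enumerate ξ) j)) (∈-map⁺ inj₂ m))) (x 0)
    ... | x* , x-lim , _ | y* , y-lim , _ =
      φ , φ-≥ , x* , y* , converges ξ (x ∘ φ) x* x-lim , converges ξ (y ∘ φ) y* y-lim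

    -- Compactness of D^{≤t}: a sequence of pairs violating the claim at every level
    -- of the enumeration would cluster at a pair with equal F-images but distinct G-images.
    modulus : ∀ F G t i → ∃ λ C → (∀ {s j} → (s , j) ∈ₗ C → s ⊑ t) ×
              (∀ x y → fun F x ≡[ C ] fun F y → at (fun G x) t i ≡ at (fun G y) t i)
    modulus F G t i = bits E (proj₁ level) , inside E {proj₁ level} , proj₂ level
      where
      E : Enumeration (_⊑ t)
      E = enumerate (down t)
      Good : ℕ → Set₁
      Good k = ∀ x y → fun F x ≡[ bits E k ] fun F y → at (fun G x) t i ≡ at (fun G y) t i
      Bad : ℕ → Set₁
      Bad k = ∃ λ x → ∃ λ y → fun F x ≡[ bits E k ] fun F y × at (fun G x) t i ≢ at (fun G y) t i
      contra : ¬ (∀ k → Bad k)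
      contra bad with convergent-subsequence (down t) (λ k → proj₁ (bad k)) (λ k → proj₁ (proj₂ (bad k)))
      ... | φ , φ-≥ , x* , y* , x→ , y→ =
        let ka , ca = x→ G (⊑-refl {t}) i
            kb , cb = y→ G (⊑-refl {t}) i
        in proj₂ (proj₂ (proj₂ (bad (φ (ka ⊔ kb)))))
             (trans (ca (m≤m⊔n ka kb)) (trans (keep→ G t limits-agree (⊑-refl {t}) i) (sym (cb (m≤n⊔m ka kb)))))
        where
        limits-agree : x* ≡≤[ t ] y*
        limits-agree = keep← F t λ {s} s⊑t j →
          let k₁ , c₁ = x→ F s⊑t j
              k₂ , c₂ = y→ F s⊑t j
              k₃ , c₃ = enumeration-covers E ((s , j) ∷ []) λ where (here refl) → s⊑t
              n  = φ (k₁ ⊔ (k₂ ⊔ k₃))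
              x , y , agrees , _ = bad n
              n₂ = m≤n⊔m k₁ (k₂ ⊔ k₃)
          in trans (sym (c₁ (m≤m⊔n k₁ (k₂ ⊔ k₃))))
               (trans (c₃ {fun F x} {fun F y}
                         (agrees ∘ monotone E (≤-trans (≤-trans (m≤n⊔m k₂ k₃) n₂) (φ-≥ _))) (here refl))
                      (c₂ (≤-trans (m≤m⊔n k₂ k₃) n₂)))
      level : ∃ Good
      level = stable {P = ∃ Good} λ ¬good → contra λ k → stable {P = Bad k} λ ¬bad →
        ¬good (k , λ x y e → stable λ ne → ¬bad (x , y , (λ {s} {j} → e {s} {j}) , ne))

-- Finite lists of bits and boxes of the product topology.

restrict : ∀ ζ → Pt → Point ζ
restrict ζ x = record
  { to   = λ (t , _) → record { to = at x t ; cong = cong (at x t) }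
  ; cong = λ {s} {t} s≈t → at-cong x {proj₁ s} {proj₁ t} s≈t
  }

_≡ᶻ[_]_ : Pt → Ξ → Pt → Set₁
x ≡ᶻ[ ζ ] y = ∀ {t} → Ξ.nodes ζ t → ∀ i → at x t i ≡ at y t i

keepᶻ→ : ∀ F ζ {x y} → x ≡ᶻ[ ζ ] y → fun F x ≡ᶻ[ ζ ] fun F y
keepᶻ→ F ζ e {t} t∈ζ = keep→ F t (λ {s} s⊑t → e (⊑-closed ζ {s} {t} s⊑t t∈ζ)) (⊑-refl {t})

keepᶻ← : ∀ F ζ {x y} → fun F x ≡ᶻ[ ζ ] fun F y → x ≡ᶻ[ ζ ] y
keepᶻ← F ζ e {t} t∈ζ = keep← F t (λ {s} s⊑t → e (⊑-closed ζ {s} {t} s⊑t t∈ζ)) (⊑-refl {t})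

-- A basic box around `d` inside `O` tests finitely many values, and `e` has the same values.
open-resp : ∀ O → Space.IsOpen D O → ∀ {d e : Space.Carrier D} → (∀ i → d ⟨$⟩ i ≡ e ⟨$⟩ i) → d ∈ O → e ∈ O
open-resp O O-open {d} {e} d≈e d∈O =
  let L , d∈L , L⊆O = O-open d d∈O in
  L⊆O e (All.map (λ {(i , O′)} (O′-resp , p) → O′-resp (d≈e i) p) d∈L)

module _ (ζ : Ξ) where

  Box : Set₂
  Box = List (Σ T (Ξ.nodes ζ) × Pred (Space.Carrier D) 1ℓ)

  _∈Box_ : Point ζ → Box → Set₂
  z ∈Box C = All (λ (t , O) → z ⟨$⟩ t ∈ O) C

  OpenBoxAt : Point ζ → Box → Set₂
  OpenBoxAt z C = All (λ (t , O) → Space.IsOpen D O × z ⟨$⟩ t ∈ O) C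

  -- An open set of `D` around a point is guaranteed by finitely many indices, hence an open box by
  -- finitely many bits. This turns openness into agreement on a list; `cylinder` is the way back.
  box-bits : ∀ x C → OpenBoxAt (restrict ζ x) C →
             ∃ λ B → (∀ {t i} → (t , i) ∈ₗ B → Ξ.nodes ζ t) × (∀ y → x ≡[ B ] y → restrict ζ y ∈Box C)
  box-bits x [] [] = [] , (λ ()) , λ _ _ → []
  box-bits x (((t , t∈ζ) , O) ∷ C) ((O-open , x∈O) ∷ x∈C) =
    let L , x∈L , L⊆O = O-open (restrict ζ x ⟨$⟩ (t , t∈ζ)) x∈O
        B′ , B′⊆ζ , box = box-bits x C x∈C in
    map (λ (i , _) → t , i) L ++ B′ ,
    (λ m → inside-ζ L B′ B′⊆ζ (∈-++⁻ (map (λ (i , _) → t , i) L) m)) ,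
    λ y e → L⊆O (restrict ζ y ⟨$⟩ (t , t∈ζ)) (all-in y L x∈L (λ {s} {j} m → e {s} {j} (∈-++⁺ˡ m))) ∷
            box y (e ∘ ∈-++⁺ʳ (map (λ (i , _) → t , i) L))
    where
    inside-ζ : ∀ (L : List (ℕ × Pred Bool 1ℓ)) B → (∀ {s j} → (s , j) ∈ₗ B → Ξ.nodes ζ s) → ∀ {s j} →
               (s , j) ∈ₗ map (λ (i , _) → t , i) L ⊎ (s , j) ∈ₗ B → Ξ.nodes ζ s
    inside-ζ L B B⊆ζ (inj₁ m) with ∈-map⁻ (λ (i , _) → t , i) m
    ... | _ , _ , refl = t∈ζ
    inside-ζ L B B⊆ζ (inj₂ m) = B⊆ζ m
    all-in : ∀ y (L : List (ℕ × Pred Bool 1ℓ)) → All (λ (i , O) → (O Respects _≡_) × at x t i ∈ O) L →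
             x ≡[ map (λ (i , _) → t , i) L ] y → All (λ (i , O) → at y t i ∈ O) L
    all-in y [] [] e = []
    all-in y (_ ∷ L) ((O-resp , x∈) ∷ xs∈) e = O-resp (e (here refl)) x∈ ∷ all-in y L xs∈ (e ∘ there)

  bit-open : ∀ i v → Space.IsOpen D (λ d → Lift 1ℓ (d ⟨$⟩ i ≡ v))
  bit-open i v d (lift d≡v) = (i , λ b → Lift 1ℓ (b ≡ v)) ∷ [] ,
    ((λ { refl p → p }) , lift d≡v) ∷ [] , λ { _ (p ∷ []) → p }

module Representation (em : ∀ {ℓ} → ExcludedMiddle ℓ) where
  open Classical em

  cylinder : ∀ ζ x B → ∃ λ C → OpenBoxAt ζ (restrict ζ x) C × (∀ y → _∈Box_ ζ y C →
             ∀ {t i} → (t , i) ∈ₗ B → ∀ t∈ζ → (y ⟨$⟩ (t , t∈ζ)) ⟨$⟩ i ≡ at x t i)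
  cylinder ζ x [] = [] , [] , λ _ _ ()
  cylinder ζ x ((t , i) ∷ B) with cylinder ζ x B | em {P = Ξ.nodes ζ t}
  -- A bit outside `ζ` puts no condition on a point of `D^ ζ`.
  ... | C , x∈C , box | no t∉ζ = C , x∈C , λ where
        y y∈C (here refl) t∈ζ → ⊥-elim (t∉ζ t∈ζ)
        y y∈C (there m) → box y y∈C m
  ... | C , x∈C , box | yes t∈ζ =
        ((t , t∈ζ) , λ d → Lift 1ℓ (d ⟨$⟩ i ≡ at x t i)) ∷ C ,
        (bit-open ζ i (at x t i) , lift refl) ∷ x∈C , λ where
          y (lift p ∷ _) (here refl) t∈ζ′ → trans (Func.cong y {t , t∈ζ′} {t , t∈ζ} (Tᵉ.refl {t}) i) p
          y (_ ∷ y∈C) (there m) → box y y∈C m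

  extend : ∀ ζ → Point ζ → Pt → Pt
  extend ζ p x = record { at = at′ ; at-cong = at′-cong }
    where
    at′ : T → ℕ → Bool
    at′ t i with em {P = Ξ.nodes ζ t}
    ... | yes t∈ζ = (p ⟨$⟩ (t , t∈ζ)) ⟨$⟩ i
    ... | no _    = at x t i
    at′-cong : ∀ {s t} → s ≈ᵀ t → ∀ i → at′ s i ≡ at′ t i
    at′-cong {s} {t} s≈t i with em {P = Ξ.nodes ζ s} | em {P = Ξ.nodes ζ t}
    ... | yes s∈ζ | yes t∈ζ = Func.cong p {s , s∈ζ} {t , t∈ζ} s≈t i
    ... | no _    | no _    = at-cong x s≈t i
    ... | yes s∈ζ | no t∉ζ  = ⊥-elim (t∉ζ (Ξ.respects ζ s≈t s∈ζ))
    ... | no s∉ζ  | yes t∈ζ = ⊥-elim (s∉ζ (Ξ.respects ζ (Tᵉ.sym {s} {t} s≈t) t∈ζ))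

  module _ (ζ : Ξ) where

    extend-in : ∀ p x {t} t∈ζ i → at (extend ζ p x) t i ≡ (p ⟨$⟩ (t , t∈ζ)) ⟨$⟩ i
    extend-in p x {t} t∈ζ i with em {P = Ξ.nodes ζ t}
    ... | yes t∈ζ′ = Func.cong p {t , t∈ζ′} {t , t∈ζ} (Tᵉ.refl {t}) i
    ... | no t∉ζ   = ⊥-elim (t∉ζ t∈ζ)

    extend-out : ∀ p x {t} → ¬ Ξ.nodes ζ t → ∀ i → at (extend ζ p x) t i ≡ at x t i
    extend-out p x {t} t∉ζ i with em {P = Ξ.nodes ζ t}
    ... | yes t∈ζ = ⊥-elim (t∉ζ t∈ζ)
    ... | no _    = refl

    extend-cong : ∀ {p q} → p ≈[ ζ ] q → ∀ x → extend ζ p x ≡ᶻ[ ζ ] extend ζ q x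
    extend-cong {p} {q} p≈q x {t} t∈ζ i =
      trans (extend-in p x t∈ζ i) (trans (p≈q (t , t∈ζ) i) (sym (extend-in q x t∈ζ i)))

  -- As `F` is the identity off `ζ`, it is enough to change `u` into `z` there.
  realize : ∀ {ζ} F → Supported ζ F → ∀ z u → fun F u ≡ᶻ[ ζ ] z → ∃ λ v → fun F v ≐ z
  realize {ζ} F supp z u e = v , λ t i → case t i em
    where
    v = extend ζ (restrict ζ u) z
    case : ∀ t i → Dec (Ξ.nodes ζ t) → at (fun F v) t i ≡ at z t i
    case t i (yes t∈ζ) = trans
      (keepᶻ→ F ζ {v} {u} (λ s∈ζ j → extend-in ζ (restrict ζ u) z s∈ζ j) t∈ζ i) (e t∈ζ i)
    case t i (no t∉ζ) = trans (supp t∉ζ v i) (extend-out ζ (restrict ζ u) z t∉ζ i)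

  -- With `F` the identity this is uniform continuity of `G`; with `G` the identity, uniform
  -- continuity of the inverse of `F`. The list `C` stays in `ζ` because moduli lie below the bits
  -- they serve.
  modulus-list : ∀ F G {ζ} B → (∀ {t i} → (t , i) ∈ₗ B → Ξ.nodes ζ t) →
                 ∃ λ C → (∀ {t i} → (t , i) ∈ₗ C → Ξ.nodes ζ t) ×
                 (∀ x y → fun F x ≡[ C ] fun F y → fun G x ≡[ B ] fun G y)
  modulus-list F G [] _ = [] , (λ ()) , λ _ _ _ ()
  modulus-list F G {ζ} ((t , i) ∷ B) B⊆ζ
    with modulus F G t i | modulus-list F G {ζ} B (B⊆ζ ∘ there)
  ... | C , C⊑t , mod | C′ , C′⊆ζ , mod′ =
    C ++ C′ , (λ {s} m → inside-ζ {s} (∈-++⁻ C m)) , λ where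
      x y e (here refl) → mod x y (λ {s} {j} m → e {s} {j} (∈-++⁺ˡ m))
      x y e (there m)   → mod′ x y (λ {s} {j} m → e {s} {j} (∈-++⁺ʳ C m)) m
    where
    inside-ζ : ∀ {s j} → (s , j) ∈ₗ C ⊎ (s , j) ∈ₗ C′ → Ξ.nodes ζ s
    inside-ζ {s} (inj₁ m) = ⊑-closed ζ {s} {t} (C⊑t m) (B⊆ζ (here refl))
    inside-ζ (inj₂ m) = C′⊆ζ m

  -- From members of `IPS` to keeping maps.

  _∈↑_ : Pt → IPS → Set₁
  x ∈↑ X = restrict (dim X) x ∈ set X

  module _ (X : IPS) where
    private
      ζ = dim X
      open IPS[_] (IPS.perfect X)
      module Hom = Homeomorphism homeomorphism
      module Inv = Inverse Hom.inverse

    parametrise : Pt → Pt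
    parametrise x = extend ζ (H (restrict ζ x)) x

    private
      K = parametrise

      K-in : ∀ x {t} (t∈ζ : Ξ.nodes ζ t) i → at (K x) t i ≡ (H (restrict ζ x) ⟨$⟩ (t , t∈ζ)) ⟨$⟩ i
      K-in x = extend-in ζ (H (restrict ζ x)) x

      below : ∀ {t} → Ξ.nodes ζ t → down t ⊆ᶻ ζ
      below {t} t∈ζ = incl λ {s} s⊑t → ⊑-closed ζ {s} {t} s⊑t t∈ζ

      keeps : ∀ {t} (t∈ζ : Ξ.nodes ζ t) x y → x ≡≤[ t ] y ⇔ K x ≡≤[ t ] K y
      keeps {t} t∈ζ x y = mk⇔
        (λ e {s} s⊑t i → trans (K-in x (incl′ s⊑t) i)
          (trans (Equivalence.to keeping (λ (s , p) → e {s} p) (s , s⊑t) i) (sym (K-in y (incl′ s⊑t) i))))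
        (λ e {s} s⊑t i → Equivalence.from keeping
          (λ (s , p) i → trans (sym (K-in x (incl′ p) i)) (trans (e {s} p i) (K-in y (incl′ p) i))) (s , s⊑t) i)
        where
        keeping = projection-keeping (restrict ζ x) (restrict ζ y) (down t) (below t∈ζ)
        incl′ : ∀ {s} → s ⊑ t → Ξ.nodes ζ s
        incl′ = _⊆ᶻ_.include (below t∈ζ)

      K-cont : ∀ x t i → Dec (Ξ.nodes ζ t) → ∃ λ C → ∀ y → x ≡[ C ] y → at (K x) t i ≡ at (K y) t i
      K-cont x t i (no t∉ζ) = (t , i) ∷ [] , λ y e →
        trans (extend-out ζ _ x t∉ζ i) (trans (e (here refl)) (sym (extend-out ζ _ y t∉ζ i)))
      K-cont x t i (yes t∈ζ) =
        -- Continuity of `H` is applied to the open set of points that share one bit with `K x`.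
        let C , x∈C , C⊆ = Hom.to-continuous (Cyl ∘ proj₁) (Cyl , Cyl-open , λ _ → mk⇔ id id)
                            (restrict ζ x) (lift (sym (K-in x t∈ζ i)))
            B , _ , box = box-bits ζ x C x∈C in
        B , λ y e → trans (sym (lower (C⊆ (restrict ζ y) (box y e)))) (sym (K-in y t∈ζ i))
        where
        Cyl : Pred (Point ζ) 1ℓ
        Cyl z = Lift 1ℓ ((z ⟨$⟩ (t , t∈ζ)) ⟨$⟩ i ≡ at (K x) t i)
        Cyl-open : Space.IsOpen (D^ ζ) Cyl
        Cyl-open z z∈ = ((t , t∈ζ) , λ d → Lift 1ℓ (d ⟨$⟩ i ≡ at (K x) t i)) ∷ [] ,
          (bit-open ζ i (at (K x) t i) , z∈) ∷ [] , λ { _ (p ∷ []) → p }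

    -- At a node `s` of `ζ` both directions are the projection-keeping property of `H` for the set
    -- `down s`; off `ζ` the map is the identity.
    parametrisation : Keeping
    parametrisation = record
      { fun   = parametrise
      ; keep→ = λ t {x} {y} e {s} s⊑t i → by-dim x y (λ s∈ζ → Equivalence.to (keeps s∈ζ x y)) e s⊑t i em
      ; keep← = λ t {x} {y} e {s} s⊑t i → by-dim′ x y e s⊑t i em
      ; cont  = λ x t i → K-cont x t i em
      }
      where
      by-dim : ∀ x y {t} → (∀ {s} → Ξ.nodes ζ s → x ≡≤[ s ] y → K x ≡≤[ s ] K y) → x ≡≤[ t ] y →
               ∀ {s} → s ⊑ t → ∀ i → Dec (Ξ.nodes ζ s) → at (K x) s i ≡ at (K y) s i
      by-dim x y {t} to e {s} s⊑t i (yes s∈ζ) =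
        to s∈ζ (λ {r} r⊑s → e (⊑-trans {r} {s} {t} r⊑s s⊑t)) (⊑-refl {s}) i
      by-dim x y {t} to e s⊑t i (no s∉ζ) =
        trans (extend-out ζ _ x s∉ζ i) (trans (e s⊑t i) (sym (extend-out ζ _ y s∉ζ i)))
      by-dim′ : ∀ x y {t} → K x ≡≤[ t ] K y → ∀ {s} → s ⊑ t → ∀ i → Dec (Ξ.nodes ζ s) → at x s i ≡ at y s i
      by-dim′ x y {t} e {s} s⊑t i (yes s∈ζ) =
        Equivalence.from (keeps s∈ζ x y) (λ {r} r⊑s → e (⊑-trans {r} {s} {t} r⊑s s⊑t)) (⊑-refl {s}) i
      by-dim′ x y {t} e s⊑t i (no s∉ζ) =
        trans (sym (extend-out ζ _ x s∉ζ i)) (trans (e s⊑t i) (extend-out ζ _ y s∉ζ i))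

    parametrisation-supported : Supported ζ parametrisation
    parametrisation-supported t∉ζ x i = extend-out ζ _ x t∉ζ i

    ∈↑-cong : ∀ {x y} → x ≐ y → x ∈↑ X → y ∈↑ X
    ∈↑-cong {x} {y} x≐y = IPS.respects X {restrict ζ x} {restrict ζ y} λ (t , _) i → x≐y t i

    parametrisation-in : ∀ u → fun parametrisation u ∈↑ X
    parametrisation-in u = IPS.respects X
      {H (restrict ζ u)} {restrict ζ (fun parametrisation u)}
      (λ (t , t∈ζ) i → sym (K-in u t∈ζ i)) (proj₂ (Hom.to (restrict ζ u)))

    parametrisation-onto : ∀ z → z ∈↑ X → ∃ λ u → fun parametrisation u ≐ z
    parametrisation-onto z z∈X = realize {ζ} parametrisation parametrisation-supported z u λ {t} t∈ζ i →
      trans (K-in u t∈ζ i) (Inv.inverseˡ {restrict ζ z , z∈X} {restrict ζ u}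
        (λ (t , t∈ζ) i → extend-in ζ w z t∈ζ i) (t , t∈ζ) i)
      where
      w = Inv.from (restrict ζ z , z∈X)
      u = extend ζ w z

  -- From keeping maps to members of `IPS`; images are closed.

  zeros : Pt
  zeros = record { at = λ _ _ → false ; at-cong = λ _ _ → refl }

  image : ∀ ζ → Keeping → Pred (Point ζ) 1ℓ
  image ζ F z = ∃ λ u → restrict ζ (fun F u) ≈[ ζ ] z

  module _ (ζ : Ξ) (F : Keeping) where
    private
      ext : Point ζ → Pt
      -- The default off `ζ` is harmless: on `ζ` the value of `F` depends on the argument on `ζ`
      -- only.
      ext p = extend ζ p zeros

      ext-in : ∀ p {t} (t∈ζ : Ξ.nodes ζ t) i → at (ext p) t i ≡ (p ⟨$⟩ (t , t∈ζ)) ⟨$⟩ i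
      ext-in p = extend-in ζ p zeros

    -- A member of the image carries a preimage `u`, so the inverse reads it off; `keepᶻ←` makes the
    -- result on `ζ` independent of the choice of `u`.
    image-inverse : Inverse (Space.setoid (D^ ζ)) (Space.setoid (Subspace (D^ ζ) (image ζ F)))
    image-inverse = record
      { to        = λ p → restrict ζ (fun F (ext p)) , ext p , λ _ _ → refl
      ; from      = λ (z , u , _) → restrict ζ u
      ; to-cong   = λ {p} {q} p≈q (t , t∈ζ) i → keepᶻ→ F ζ {ext p} {ext q} (extend-cong ζ {p} {q} p≈q zeros) t∈ζ i
      ; from-cong = λ {(z , u , e)} {(z′ , u′ , e′)} z≈z′ (t , t∈ζ) i → keepᶻ← F ζ {u} {u′}
          (λ {s} s∈ζ j → trans (e (s , s∈ζ) j) (trans (z≈z′ (s , s∈ζ) j) (sym (e′ (s , s∈ζ) j)))) t∈ζ i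
      ; inverse   =
          (λ {(z , u , e)} {p} p≈u (t , t∈ζ) i → trans
            (keepᶻ→ F ζ {ext p} {u} (λ {s} s∈ζ j → trans (ext-in p s∈ζ j) (p≈u (s , s∈ζ) j)) t∈ζ i)
            (e (t , t∈ζ) i)) ,
          (λ {p} {(z , u , e)} z≈Fp (t , t∈ζ) i → trans
            (keepᶻ← F ζ {u} {ext p} (λ {s} s∈ζ j → trans (e (s , s∈ζ) j) (z≈Fp (s , s∈ζ) j)) t∈ζ i)
            (ext-in p t∈ζ i))
      }

    image-to-continuous : Continuous (D^ ζ) (Subspace (D^ ζ) (image ζ F)) (Inverse.to image-inverse)
    image-to-continuous U (U′ , U′-open , U⇔U′) p p∈U =
      let C , Fp∈C , C⊆U′ = U′-open (restrict ζ (fun F (ext p))) (Equivalence.to (U⇔U′ _) p∈U)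
          B , B⊆ζ , box = box-bits ζ (fun F (ext p)) C Fp∈C
          B′ , F-cont = cont-list F (ext p) B
          C′ , p∈C′ , cyl = cylinder ζ (ext p) B′
      in C′ , All.map (λ {(t , O)} (O-open , p∈O) → O-open , open-resp O O-open (λ i → ext-in p (proj₂ t) i) p∈O) p∈C′ ,
         λ q q∈C′ → Equivalence.from (U⇔U′ _) (C⊆U′ _ (box (fun F (ext q))
           (F-cont (ext q) (λ {t} {i} m → agree q t i (λ t∈ζ → cyl q q∈C′ m t∈ζ) em))))
      where
      agree : ∀ q t i → (∀ t∈ζ → (q ⟨$⟩ (t , t∈ζ)) ⟨$⟩ i ≡ at (ext p) t i) → Dec (Ξ.nodes ζ t) →
              at (ext p) t i ≡ at (ext q) t i
      agree q t i e (yes t∈ζ) = trans (sym (e t∈ζ)) (sym (ext-in q t∈ζ i))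
      agree q t i e (no t∉ζ)  = trans (extend-out ζ p zeros t∉ζ i) (sym (extend-out ζ q zeros t∉ζ i))

    image-from-continuous : Continuous (Subspace (D^ ζ) (image ζ F)) (D^ ζ) (Inverse.from image-inverse)
    image-from-continuous U U-open = U′ , U′-open , λ z → mk⇔ (to z) (from z)
      where
      Meets : Point ζ → List Bit → Pt → Set₁
      Meets z B w = ∀ {t i} → (t , i) ∈ₗ B → ∀ t∈ζ → (z ⟨$⟩ (t , t∈ζ)) ⟨$⟩ i ≡ at (fun F w) t i
      -- An open set of the subspace must come from one of `D^ ζ`, so `U′` is defined off the image
      -- as well: some finite list of bits of `z` forces every point whose `F`-value matches it into
      -- `U`. For a `z` with preimage in `U` the modulus of the inverse supplies the list.
      U′ : Pred (Point ζ) 1ℓ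
      U′ z = ∃ λ B → ∀ w → Meets z B w → restrict ζ w ∈ U
      U′-open : Space.IsOpen (D^ ζ) U′
      U′-open z (B , B⊆U) =
        let C , z∈C , cyl = cylinder ζ (ext z) B in
        C , All.map (λ {(t , O)} (O-open , p) → O-open , open-resp O O-open (λ i → ext-in z (proj₂ t) i) p) z∈C ,
        λ y y∈C → B , λ w y-meets → B⊆U w λ m t∈ζ →
          trans (sym (trans (cyl y y∈C m t∈ζ) (ext-in z t∈ζ _))) (y-meets m t∈ζ)
      to : ∀ ((z , u , _) : ∃ (image ζ F)) → restrict ζ u ∈ U → z ∈ U′
      to (z , u , Fu≈z) u∈U =
        let C , u∈C , C⊆U = U-open (restrict ζ u) u∈U
            B , B⊆ζ , box = box-bits ζ u C u∈C
            B′ , B′⊆ζ , mod = modulus-list F idᴷ {ζ} B B⊆ζ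
        in B′ , λ w z-meets → C⊆U (restrict ζ w) (box w (mod u w λ {t} m →
             trans (Fu≈z (t , B′⊆ζ m) _) (z-meets m (B′⊆ζ m))))
      from : ∀ ((z , u , _) : ∃ (image ζ F)) → z ∈ U′ → restrict ζ u ∈ U
      from (z , u , Fu≈z) (B , B⊆U) = B⊆U u λ {t} m t∈ζ → sym (Fu≈z (t , t∈ζ) _)

    imageᴵ : IPS
    imageᴵ = record
      { dim      = ζ
      ; set      = image ζ F
      ; respects = λ z≈z′ (u , e) → u , λ t i → trans (e t i) (z≈z′ t i)
      ; perfect  = record
        { homeomorphism = record
          { inverse         = image-inverse
          ; to-continuous   = image-to-continuous
          ; from-continuous = image-from-continuous
          }
        ; projection-keeping = λ p q η η⊆ζ → mk⇔
            (λ e (t , t∈η) i → keepᶻ→ F η {ext p} {ext q} (λ {s} s∈η j → trans (ext-in p (_⊆ᶻ_.include η⊆ζ s∈η) j)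
              (trans (e (s , s∈η) j) (sym (ext-in q (_⊆ᶻ_.include η⊆ζ s∈η) j)))) t∈η i)
            (λ e (t , t∈η) i → trans (sym (ext-in p (_⊆ᶻ_.include η⊆ζ t∈η) i)) (trans
              (keepᶻ← F η {ext p} {ext q} (λ {s} s∈η j → e (s , s∈η) j) t∈η i)
              (ext-in q (_⊆ᶻ_.include η⊆ζ t∈η) i)))
        }
      }

  -- The bits of `z` in `guard t i` decide bit `i` at `t` of any preimage. That bit is read off from
  -- an approximate preimage, and the bits so found fit together.
  closed-image : ∀ F z → (∀ C → ∃ λ v → fun F v ≡[ C ] z) → ∃ λ v → fun F v ≐ z
  closed-image F z approx = v , λ t i →
    let B , F-cont = cont F v t i
        C , mod = guard-list B
        -- `C` makes `w` agree with `v` on the bits that decide `F v` at `(t , i)`; the extra bit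
        -- compares `F w` with `z` there.
        w , Fw≡z = approx ((t , i) ∷ C)
    in trans (F-cont w (mod w (Fw≡z ∘ there))) (Fw≡z (here refl))
    where
    guard : T → ℕ → List Bit
    guard t i = proj₁ (modulus F idᴷ t i)
    determined : ∀ x y t i → fun F x ≡[ guard t i ] z → fun F y ≡[ guard t i ] z → at x t i ≡ at y t i
    determined x y t i Fx≡z Fy≡z = proj₂ (proj₂ (modulus F idᴷ t i)) x y
      (λ {s} {j} m → trans (Fx≡z {s} {j} m) (sym (Fy≡z {s} {j} m)))
    value : T → ℕ → Bool
    value t i = at (proj₁ (approx (guard t i))) t i
    value-unique : ∀ w t i → fun F w ≡[ guard t i ] z → value t i ≡ at w t i
    value-unique w t i Fw≡z = determined _ w t i (proj₂ (approx (guard t i))) Fw≡z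
    v : Pt
    v = record
      { at      = value
      ; at-cong = λ {s} {t} s≈t i → let w , Fw≡z = approx (guard s i ++ guard t i) in
          trans (value-unique w s i (λ {r} {j} m → Fw≡z {r} {j} (∈-++⁺ˡ m))) (trans (at-cong w s≈t i)
            (sym (value-unique w t i (λ {r} {j} m → Fw≡z {r} {j} (∈-++⁺ʳ (guard s i) m)))))
      }
    guard-list : ∀ B → ∃ λ C → ∀ w → fun F w ≡[ C ] z → v ≡[ B ] w
    guard-list [] = [] , λ _ _ ()
    guard-list ((t , i) ∷ B) = let C , mod = guard-list B in guard t i ++ C , λ where
      w e (here refl) → value-unique w t i (λ {r} {j} m → e {r} {j} (∈-++⁺ˡ m))
      w e (there m)   → mod w (λ {r} {j} m → e {r} {j} (∈-++⁺ʳ (guard t i) m)) m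

  closed : ∀ X z → (∀ C → ∃ λ x → x ∈↑ X × x ≡[ C ] z) → z ∈↑ X
  closed X z approx =
    let v , Kv≐z = closed-image (parametrisation X) z λ C →
          let x , x∈X , x≡z = approx C ; u , Ku≐x = parametrisation-onto X x x∈X in
          u , λ {t} {i} m → trans (Ku≐x t i) (x≡z m)
    in ∈↑-cong X {fun (parametrisation X) v} {z} Kv≐z (parametrisation-in X v)

-- Windows, that is, initial segments at finitely many nodes, and maps onto their cells.

insert : ℕ → (ℕ → Bool) → (ℕ → Bool) → ℕ → Bool
insert zero    p u i       = u i
insert (suc w) p u zero    = p 0
insert (suc w) p u (suc i) = insert w (p ∘ suc) u i

insert-< : ∀ w p u {i} → i < w → insert w p u i ≡ p i
insert-< (suc w) p u {zero}  _         = refl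
insert-< (suc w) p u {suc i} (s≤s i<w) = insert-< w (p ∘ suc) u i<w

insert-+ : ∀ w p u i → insert w p u (w + i) ≡ u i
insert-+ zero    p u i = refl
insert-+ (suc w) p u i = insert-+ w (p ∘ suc) u i

insert-≥ : ∀ w p u {i} → w ≤ i → insert w p u i ≡ u (i ∸ w)
insert-≥ w p u {i} w≤i = trans (cong (insert w p u) (sym (m+[n∸m]≡n w≤i))) (insert-+ w p u (i ∸ w))

insert-cong : ∀ w {p q u v} → (∀ i → p i ≡ q i) → (∀ i → u i ≡ v i) → ∀ i → insert w p u i ≡ insert w q v i
insert-cong zero    p≡q u≡v i       = u≡v i
insert-cong (suc w) p≡q u≡v zero    = p≡q 0
insert-cong (suc w) p≡q u≡v (suc i) = insert-cong w (p≡q ∘ suc) u≡v i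

insert-injective : ∀ w p {u v} → (∀ i → insert w p u i ≡ insert w p v i) → ∀ i → u i ≡ v i
insert-injective w p {u} {v} e i = trans (sym (insert-+ w p u i)) (trans (e (w + i)) (insert-+ w p v i))

module Splitting (em : ∀ {ℓ} → ExcludedMiddle ℓ) where
  open Classical em
  open Representation em

  -- A window is an initial segment of indices at every node instead of an arbitrary set of bits, so
  -- each of its cells is a product of basic cylinders of `D` and thus a copy of the whole space.
  -- The `suc` puts index `i` itself inside.
  width : List Bit → T → ℕ
  width [] t = 0
  width ((s , i) ∷ C) t with em {P = s ≈ᵀ t}
  ... | yes _ = suc i ⊔ width C t
  ... | no _  = width C t

  width-cong : ∀ C {s t} → s ≈ᵀ t → width C s ≡ width C t
  width-cong [] _ = refl
  width-cong ((r , i) ∷ C) {s} {t} s≈t with em {P = r ≈ᵀ s} | em {P = r ≈ᵀ t}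
  ... | yes _   | yes _   = cong (suc i ⊔_) (width-cong C {s} {t} s≈t)
  ... | no _    | no _    = width-cong C {s} {t} s≈t
  ... | yes r≈s | no r≉t  = ⊥-elim (r≉t (Tᵉ.trans {r} {s} {t} r≈s s≈t))
  ... | no r≉s  | yes r≈t = ⊥-elim (r≉s (Tᵉ.trans {r} {t} {s} r≈t (Tᵉ.sym {s} {t} s≈t)))

  width-∈ : ∀ {C t i} → (t , i) ∈ₗ C → i < width C t
  width-∈ {(t , i) ∷ C} (here refl) with em {P = t ≈ᵀ t}
  ... | yes _  = m≤m⊔n (suc i) (width C t)
  ... | no t≉t = ⊥-elim (t≉t (Tᵉ.refl {t}))
  width-∈ {(s , j) ∷ C} {t} (there m) with em {P = s ≈ᵀ t}
  ... | yes _ = ≤-trans (width-∈ m) (m≤n⊔m (suc j) (width C t))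
  ... | no _  = width-∈ m

  width-++ : ∀ B C t → width C t ≤ width (B ++ C) t
  width-++ [] C t = ≤-refl
  width-++ ((s , i) ∷ B) C t with em {P = s ≈ᵀ t}
  ... | yes _ = ≤-trans (width-++ B C t) (m≤n⊔m (suc i) (width (B ++ C) t))
  ... | no _  = width-++ B C t

  width-outside : ∀ ζ C → (∀ {t i} → (t , i) ∈ₗ C → Ξ.nodes ζ t) → ∀ {t} → ¬ Ξ.nodes ζ t → width C t ≡ 0
  width-outside ζ [] C⊆ζ t∉ζ = refl
  width-outside ζ ((s , i) ∷ C) C⊆ζ {t} t∉ζ with em {P = s ≈ᵀ t}
  ... | yes s≈t = ⊥-elim (t∉ζ (Ξ.respects ζ {s} {t} s≈t (C⊆ζ (here refl))))
  ... | no _    = width-outside ζ C (C⊆ζ ∘ there) t∉ζ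

  _≡⟨_⟩_ : Pt → List Bit → Pt → Set₁
  x ≡⟨ C ⟩ y = ∀ t {i} → i < width C t → at x t i ≡ at y t i

  -- Fills in the indices below each listed one, so that agreement on a list implies agreement on
  -- the window.
  closure : List Bit → List Bit
  closure [] = []
  closure ((s , i) ∷ C) = map (s ,_) (upTo (suc i)) ++ closure C

  closure-width : ∀ C x y → x ≡[ closure C ] y → x ≡⟨ C ⟩ y
  closure-width [] x y e t ()
  closure-width ((s , i) ∷ C) x y e t {j} j< with em {P = s ≈ᵀ t}
  ... | no _ = closure-width C x y (λ m → e (∈-++⁺ʳ (map (s ,_) (upTo (suc i))) m)) t j<
  ... | yes s≈t with <-≤-connex j (suc i)
  ... | inj₁ j<1+i = trans (sym (at-cong x s≈t j))
          (trans (e (∈-++⁺ˡ (∈-map⁺ (s ,_) (∈-upTo⁺ j<1+i)))) (at-cong y s≈t j))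
  ... | inj₂ 1+i≤j = closure-width C x y (λ m → e (∈-++⁺ʳ (map (s ,_) (upTo (suc i))) m)) t
          (⊔-cancel j<)
    where
    ⊔-cancel : ∀ {w} → j < suc i ⊔ w → j < w
    ⊔-cancel {w} j< with ⊔-sel (suc i) w
    ... | inj₁ e = ⊥-elim (<⇒≱ (subst (j <_) e j<) 1+i≤j)
    ... | inj₂ e = subst (j <_) e j<

  -- Each further bit doubles the list of representatives, one for either value. A cell may be
  -- represented more than once.
  finite-cover : ∀ C → ∃ λ ps → ∀ x → ∃ λ p → p ∈ₗ ps × x ≡[ C ] p
  finite-cover [] = zeros ∷ [] , λ x → zeros , here refl , λ ()
  finite-cover ((t , i) ∷ C) with finite-cover C
  ... | ps , covers = map (put true) ps ++ map (put false) ps , λ x →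
        let p , p∈ps , x≡p = covers x in
        put (at x t i) p , put-∈ (at x t i) p∈ps , λ where
          (here refl) → sym (splice-in Here Here-resp (const′ (at x t i)) p (Tᵉ.refl {t} , refl))
          {s} {j} (there m) → put-agrees x p s j (x≡p m) em
    where
    Here : T → ℕ → Set₁
    Here s j = t ≈ᵀ s × i ≡ j
    Here-resp : ∀ {r s j} → r ≈ᵀ s → Here r j → Here s j
    Here-resp {r} {s} r≈s (t≈r , e) = Tᵉ.trans {t} {r} {s} t≈r r≈s , e
    const′ : Bool → Pt
    const′ b = record { at = λ _ _ → b ; at-cong = λ _ _ → refl }
    put : Bool → Pt → Pt
    put b p = splice Here Here-resp (const′ b) p
    put-∈ : ∀ b {p ps} → p ∈ₗ ps → put b p ∈ₗ map (put true) ps ++ map (put false) ps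
    put-∈ true  m = ∈-++⁺ˡ (∈-map⁺ (put true) m)
    put-∈ false {ps = ps} m = ∈-++⁺ʳ (map (put true) ps) (∈-map⁺ (put false) m)
    put-agrees : ∀ x p s j → at x s j ≡ at p s j → Dec (Here s j) → at x s j ≡ at (put (at x t i) p) s j
    put-agrees x p s j e (yes (t≈s , refl)) = trans (sym (at-cong x t≈s j))
      (sym (splice-in Here Here-resp (const′ (at x t i)) p (t≈s , refl)))
    put-agrees x p s j e (no ¬h) = trans e (sym (splice-out Here Here-resp (const′ (at x t i)) p ¬h))

  -- Carries all points onto the window cell of `p` by shifting each sequence behind the window;
  -- `strip C` is the inverse on that cell. Working node by node makes it keep projections.
  insertᴷ : List Bit → Pt → Keeping
  insertᴷ C p = record
    { fun   = ins
    ; keep→ = λ t e {s} s⊑t → insert-cong (width C s) (λ _ → refl) (e s⊑t)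
    ; keep← = λ t e {s} s⊑t → insert-injective (width C s) (at p s) (e s⊑t)
    ; cont  = ins-cont
    }
    where
    ins : Pt → Pt
    ins u = record
      { at      = λ t → insert (width C t) (at p t) (at u t)
      ; at-cong = λ {s} {t} s≈t i → trans
          (cong (λ w → insert w (at p s) (at u s) i) (width-cong C {s} {t} s≈t))
          (insert-cong (width C t) (at-cong p s≈t) (at-cong u s≈t) i)
      }
    ins-cont : ∀ u t i → ∃ λ B → ∀ v → u ≡[ B ] v → at (ins u) t i ≡ at (ins v) t i
    ins-cont u t i with <-≤-connex i (width C t)
    ... | inj₁ i<w = [] , λ v _ →
          trans (insert-< (width C t) (at p t) (at u t) i<w) (sym (insert-< (width C t) (at p t) (at v t) i<w))
    ... | inj₂ w≤i = (t , i ∸ width C t) ∷ [] , λ v e →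
          trans (insert-≥ (width C t) (at p t) (at u t) w≤i)
            (trans (e (here refl)) (sym (insert-≥ (width C t) (at p t) (at v t) w≤i)))

  strip : List Bit → Pt → Pt
  strip C x = record
    { at      = λ t i → at x t (width C t + i)
    ; at-cong = λ {s} {t} s≈t i → trans (cong (λ w → at x s (w + i)) (width-cong C {s} {t} s≈t))
                                        (at-cong x s≈t (width C t + i))
    }

  -- This is `K` followed by the inverse of `F`, continuous since that inverse has a uniform
  -- modulus.
  factor : ∀ F K → (∀ x → ∃ λ u → fun F u ≐ fun K x) → Keeping
  factor F K sol = record
    { fun   = M
    ; keep→ = λ t {x} {y} e → keep← F t λ {s} s⊑t i →
        trans (proj₂ (sol x) s i) (trans (keep→ K t {x} {y} e s⊑t i) (sym (proj₂ (sol y) s i)))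
    ; keep← = λ t {x} {y} e → keep← K t λ {s} s⊑t i →
        trans (sym (proj₂ (sol x) s i)) (trans (keep→ F t {M x} {M y} e s⊑t i) (proj₂ (sol y) s i))
    ; cont  = λ x t i →
        let B , _ , mod = modulus F idᴷ t i
            C , K-cont = cont-list K x B
        in C , λ y e → mod (M x) (M y) λ {s} {j} m →
             trans (proj₂ (sol x) s j) (trans (K-cont y e m) (sym (proj₂ (sol y) s j)))
    }
    where
    M : Pt → Pt
    M x = proj₁ (sol x)

-- Grafting a map onto one window cell.

module Fusion (em : ∀ {ℓ} → ExcludedMiddle ℓ) where
  open Classical em
  open Representation em
  open Splitting em

  ≡⟨⟩-sym : ∀ C {x y} → x ≡⟨ C ⟩ y → y ≡⟨ C ⟩ x
  ≡⟨⟩-sym C e t i< = sym (e t i<)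

  ≡⟨⟩-trans : ∀ C {x y z} → x ≡⟨ C ⟩ y → y ≡⟨ C ⟩ z → x ≡⟨ C ⟩ z
  ≡⟨⟩-trans C e f t i< = trans (e t i<) (f t i<)

  -- M is grafted onto the points of the window cell of p and the identity elsewhere.
  -- Deciding membership in the cell separately at each node t, from the coordinates
  -- below t only, is what makes the result keep projections.
  module _ (C : List Bit) (p : Pt) (M : Keeping) where
    private
      N : Keeping
      N = insertᴷ C p ∘ᴷ M

    AgreesBelow : Pt → T → Set₁
    AgreesBelow x t = ∀ {s} → s ⊑ t → ∀ {i} → i < width C s → at x s i ≡ at p s i

    AgreesBelow-⊑ : ∀ x {s t} → s ⊑ t → AgreesBelow x t → AgreesBelow x s
    AgreesBelow-⊑ x {s} {t} s⊑t a {r} r⊑s = a (⊑-trans {r} {s} {t} r⊑s s⊑t)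

    AgreesBelow-transfer : ∀ x y {t} → (∀ {s} → s ⊑ t → ∀ {i} → i < width C s → at x s i ≡ at y s i) →
                           AgreesBelow x t → AgreesBelow y t
    AgreesBelow-transfer x y e a s⊑t i< = trans (sym (e s⊑t i<)) (a s⊑t i<)

    strip-cong : ∀ {x y} t → (∀ i → at x t i ≡ at y t i) → ∀ i → at (strip C x) t i ≡ at (strip C y) t i
    strip-cong t e i = e (width C t + i)

    graft : Pt → Pt
    graft x = record { at = at′ ; at-cong = at′-cong }
      where
      at′ : T → ℕ → Bool
      at′ t i with em {P = AgreesBelow x t}
      ... | yes _ = at (fun N (strip C x)) t i
      ... | no _  = at x t i
      at′-cong : ∀ {s t} → s ≈ᵀ t → ∀ i → at′ s i ≡ at′ t i
      at′-cong {s} {t} s≈t i with em {P = AgreesBelow x s} | em {P = AgreesBelow x t}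
      ... | yes _ | yes _ = at-cong (fun N (strip C x)) {s} {t} s≈t i
      ... | no _  | no _  = at-cong x s≈t i
      ... | yes a | no ¬a = ⊥-elim (¬a (AgreesBelow-⊑ x {t} {s} (inj₁ (Tᵉ.sym {s} {t} s≈t)) a))
      ... | no ¬a | yes a = ⊥-elim (¬a (AgreesBelow-⊑ x {s} {t} (inj₁ s≈t) a))

    graft-in : ∀ x t i → AgreesBelow x t → at (graft x) t i ≡ at (fun N (strip C x)) t i
    graft-in x t i a with em {P = AgreesBelow x t}
    ... | yes _ = refl
    ... | no ¬a = ⊥-elim (¬a a)

    graft-out : ∀ x t i → ¬ AgreesBelow x t → at (graft x) t i ≡ at x t i
    graft-out x t i ¬a with em {P = AgreesBelow x t}
    ... | yes a = ⊥-elim (¬a a)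
    ... | no _  = refl

    -- Where the graft acts it writes the window of `p`, which `x` already has there.
    graft-window : ∀ x → graft x ≡⟨ C ⟩ x
    graft-window x t {i} i< with em {P = AgreesBelow x t}
    ... | yes a = trans (insert-< (width C t) (at p t) _ i<) (sym (a (⊑-refl {t}) i<))
    ... | no _  = refl

    private
      strip-restores : ∀ x y t → (∀ {i} → i < width C t → at x t i ≡ at y t i) →
                       (∀ i → at (strip C x) t i ≡ at (strip C y) t i) → ∀ i → at x t i ≡ at y t i
      strip-restores x y t below above i with <-≤-connex i (width C t)
      ... | inj₁ i<w = below i<w
      ... | inj₂ w≤i = subst (λ j → at x t j ≡ at y t j) (m+[n∸m]≡n w≤i) (above (i ∸ width C t))

      forth : ∀ x y t → x ≡≤[ t ] y → ∀ {s} → s ⊑ t → ∀ i → Dec (AgreesBelow x s) → at (graft x) s i ≡ at (graft y) s i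
      forth x y t e {s} s⊑t i (yes a) = trans (graft-in x s i a) (trans
        (keep→ N s {strip C x} {strip C y}
          (λ {r} r⊑s → strip-cong {x} {y} r (e (⊑-trans {r} {s} {t} r⊑s s⊑t))) (⊑-refl {s}) i)
        (sym (graft-in y s i (AgreesBelow-transfer x y (λ {r} r⊑s _ → e (⊑-trans {r} {s} {t} r⊑s s⊑t) _) a))))
      forth x y t e {s} s⊑t i (no ¬a) = trans (graft-out x s i ¬a) (trans (e s⊑t i)
        (sym (graft-out y s i (¬a ∘ AgreesBelow-transfer y x (λ {r} r⊑s _ → sym (e (⊑-trans {r} {s} {t} r⊑s s⊑t) _))))))

      back : ∀ x y t → graft x ≡≤[ t ] graft y → ∀ {s} → s ⊑ t → ∀ i → Dec (AgreesBelow x s) → at x s i ≡ at y s i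
      back x y t e {s} s⊑t i d = case d
        where
        -- Windows survive grafting, so `x` and `y` pass the test at `s` together and were treated
        -- by the same case.
        window : ∀ {r} → r ⊑ s → ∀ {j} → j < width C r → at x r j ≡ at y r j
        window {r} r⊑s {j} j< = trans (sym (graft-window x r j<))
          (trans (e (⊑-trans {r} {s} {t} r⊑s s⊑t) j) (graft-window y r j<))
        case : Dec (AgreesBelow x s) → at x s i ≡ at y s i
        case (yes a) = strip-restores x y s (window (⊑-refl {s})) (keep← N s {strip C x} {strip C y} (λ {r} r⊑s j →
          trans (sym (graft-in x r j (AgreesBelow-⊑ x {r} {s} r⊑s a))) (trans (e (⊑-trans {r} {s} {t} r⊑s s⊑t) j)
            (graft-in y r j (AgreesBelow-⊑ y {r} {s} r⊑s (AgreesBelow-transfer x y window a))))) (⊑-refl {s})) i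
        case (no ¬a) = trans (sym (graft-out x s i ¬a)) (trans (e s⊑t i)
          (graft-out y s i (¬a ∘ AgreesBelow-transfer y x λ r⊑s j< → sym (window r⊑s j<))))

      shift : List Bit → List Bit
      shift = map (λ (s , j) → s , width C s + j)

      graft-cont : ∀ x t i → Dec (AgreesBelow x t) →
                   ∃ λ B → ∀ y → x ≡[ B ] y → at (graft x) t i ≡ at (graft y) t i
      graft-cont x t i (yes a) = let B , N-cont = cont N (strip C x) t i in
        -- `closure C` keeps `y` in the same case as `x`; `shift B` makes up for the indices that
        -- `strip` moves down by the width of the window.
        closure C ++ shift B , λ y e → trans (graft-in x t i a) (trans
          (N-cont (strip C y) (λ {s} {j} m → e (∈-++⁺ʳ (closure C) (∈-map⁺ (λ (s , j) → s , width C s + j) m))))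
          (sym (graft-in y t i (AgreesBelow-transfer x y (λ {s} _ → closure-width C x y (e ∘ ∈-++⁺ˡ) s) a))))
      graft-cont x t i (no ¬a) = (t , i) ∷ closure C , λ y e → trans (graft-out x t i ¬a) (trans (e (here refl))
          (sym (graft-out y t i (¬a ∘ AgreesBelow-transfer y x λ {s} _ j< → sym (closure-width C x y (e ∘ there) s j<)))))

    graftᴷ : Keeping
    graftᴷ = record
      { fun   = graft
      ; keep→ = λ t {x} {y} e {s} s⊑t i → forth x y t e s⊑t i em
      ; keep← = λ t {x} {y} e {s} s⊑t i → back x y t e s⊑t i em
      ; cont  = λ x t i → graft-cont x t i em
      }

    graft-cell : ∀ x → x ≡⟨ C ⟩ p → graft x ≐ fun N (strip C x)
    graft-cell x e t i = graft-in x t i λ {s} _ → e s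

    graft-supported : ∀ ζ → (∀ {t i} → (t , i) ∈ₗ C → Ξ.nodes ζ t) → Supported ζ M → Supported ζ graftᴷ
    graft-supported ζ C⊆ζ supp {t} t∉ζ x i with em {P = AgreesBelow x t}
    ... | no _  = refl
    ... | yes _ rewrite width-outside ζ C C⊆ζ t∉ζ =
          trans (supp t∉ζ (strip C x) i) (cong (λ w → at x t (w + i)) (width-outside ζ C C⊆ζ t∉ζ))

  -- Refining all cells of a window.

  record Refinement (ζ : Ξ) (P : Keeping) (C : List Bit) (𝒴 : Pred IPS 2ℓ) (ps : List Pt) : Set₂ where
    field
      ζ′        : Ξ
      ζ⊆ζ′      : ζ ⊆ᶻ ζ′
      G         : Keeping
      supported : Supported ζ′ G
      window    : ∀ x → fun G x ≡⟨ C ⟩ x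
      pieces    : List IPS
      chosen    : All (_∈ 𝒴) pieces
      dims      : ∀ {Y} → Y ∈ₗ pieces → dim Y ⊆ᶻ ζ′
      lands     : ∀ {p} → p ∈ₗ ps → ∃ λ Y → Y ∈ₗ pieces × (∀ x → x ≡⟨ C ⟩ p → fun P (fun G x) ∈↑ Y)
      within    : ∀ {Y} → Y ∈ₗ pieces → ∀ z → z ∈↑ Y → ∃ λ x → (∃ λ p → p ∈ₗ ps × x ≡⟨ C ⟩ p) × fun P x ≐ z
      disjoint  : AllPairs (λ Y Z → ∀ z → z ∈↑ Y → ¬ (z ∈↑ Z)) pieces

  record CellRefinement (ζ : Ξ) (P : Keeping) (C : List Bit) (𝒴 : Pred IPS 2ℓ) (p : Pt) : Set₂ where
    field
      Y         : IPS
      Y∈𝒴       : Y ∈ 𝒴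
      ζ⊆Y       : ζ ⊆ᶻ dim Y
      G         : Keeping
      supported : Supported (dim Y) G
      window    : ∀ x → fun G x ≡⟨ C ⟩ x
      lands     : ∀ x → x ≡⟨ C ⟩ p → fun P (fun G x) ∈↑ Y
      within    : ∀ z → z ∈↑ Y → ∃ λ x → x ≡⟨ C ⟩ p × fun P x ≐ z

  module _ (ζ : Ξ) (P : Keeping) (P-supp : Supported ζ P) (C : List Bit)
           (C⊆ζ : ∀ {t i} → (t , i) ∈ₗ C → Ξ.nodes ζ t) (𝒴 : Pred IPS 2ℓ) (dense : Dense 𝒴) where

    -- Density gives `Y` below the image of the cell under `P`. Its parametrisation `K` is `Q` after
    -- some `M`, and grafting `M` onto the cell turns `P` there into `K` after `strip`, with values
    -- in `Y`.
    refine-cell : ∀ p → CellRefinement ζ P C 𝒴 p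
    refine-cell p with dense (imageᴵ ζ (P ∘ᴷ insertᴷ C p))
    ... | Y , Y∈𝒴 , ζ⊆Y , Y⊆Q = record
      { Y         = Y
      ; Y∈𝒴       = Y∈𝒴
      ; ζ⊆Y       = ζ⊆Y
      ; G         = graftᴷ C p M
      ; supported = graft-supported C p M (dim Y) (λ m → _⊆ᶻ_.include ζ⊆Y (C⊆ζ m)) M-supp
      ; window    = graft-window C p M
      ; lands     = λ x x≡p → ∈↑-cong Y {fun K (strip C x)} {fun P (graft C p M x)}
          (λ t i → trans (sym (proj₂ (sol (strip C x)) t i))
                         (fun-cong P {fun (insertᴷ C p) (fun M (strip C x))} {graft C p M x}
                           (λ s j → sym (graft-cell C p M x x≡p s j)) t i))
          (parametrisation-in Y (strip C x))
      ; within    = λ z z∈Y → let u , Qu≐z = preimage z z∈Y in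
          fun (insertᴷ C p) u , (λ t → insert-< (width C t) (at p t) (at u t)) , Qu≐z
      }
      where
      Q K : Keeping
      Q = P ∘ᴷ insertᴷ C p
      K = parametrisation Y
      Q-supp : Supported ζ Q
      Q-supp {t} t∉ζ u i = trans (P-supp t∉ζ (fun (insertᴷ C p) u) i)
        (cong (λ w → insert w (at p t) (at u t) i) (width-outside ζ C C⊆ζ t∉ζ))
      preimage : ∀ z → z ∈↑ Y → ∃ λ u → fun Q u ≐ z
      preimage z z∈Y =
        let u , Qu≐z = Y⊆Q {restrict ζ z} (restrict (dim Y) z , z∈Y , λ _ _ → refl) in
        realize {ζ} Q Q-supp z u λ {t} t∈ζ i → Qu≐z (t , t∈ζ) i
      sol : ∀ x → ∃ λ u → fun Q u ≐ fun K x
      sol x = preimage (fun K x) (parametrisation-in Y x)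
      M : Keeping
      M = factor Q K sol
      -- Off `dim Y` both `Q` and `K` are the identity, hence so is `M`.
      M-supp : Supported (dim Y) M
      M-supp {t} t∉Y x i = trans (sym (Q-supp (t∉Y ∘ _⊆ᶻ_.include ζ⊆Y) (fun M x) i))
        (trans (proj₂ (sol x) t i) (parametrisation-supported Y t∉Y x i))

  -- One cell is treated after another. `within` confines every piece to the `P`-image of the
  -- treated cells, which keeps the next piece disjoint from it.
  refine-cells : ∀ ζ P → Supported ζ P → ∀ C → (∀ {t i} → (t , i) ∈ₗ C → Ξ.nodes ζ t) →
                 ∀ 𝒴 → Dense 𝒴 → ∀ ps → Refinement ζ P C 𝒴 ps
  refine-cells ζ P P-supp C C⊆ζ 𝒴 dense [] = record
    { ζ′        = ζ
    ; ζ⊆ζ′      = incl id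
    ; G         = idᴷ
    ; supported = λ _ _ _ → refl
    ; window    = λ _ _ _ → refl
    ; pieces    = []
    ; chosen    = []
    ; dims      = λ ()
    ; lands     = λ ()
    ; within    = λ ()
    ; disjoint  = []
    }
  refine-cells ζ P P-supp C C⊆ζ 𝒴 dense (p ∷ ps)
    with refine-cells ζ P P-supp C C⊆ζ 𝒴 dense ps | em {P = ∃ λ q → q ∈ₗ ps × p ≡⟨ C ⟩ q}
  -- A second representative of a treated cell is skipped: a new piece for it would lie inside the
  -- old one.
  ... | R | yes (q , q∈ps , p≡q) = record
    { ζ′        = R.ζ′
    ; ζ⊆ζ′      = R.ζ⊆ζ′
    ; G         = R.G
    ; supported = R.supported
    ; window    = R.window
    ; pieces    = R.pieces
    ; chosen    = R.chosen
    ; dims      = R.dims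
    ; lands     = λ where
        (here refl) → let Y , Y∈ , land = R.lands q∈ps in Y , Y∈ , λ x x≡p → land x (≡⟨⟩-trans C {x} {p} {q} x≡p p≡q)
        (there m)   → R.lands m
    ; within    = λ Y∈ z z∈Y → let x , (r , r∈ps , x≡r) , Px≐z = R.within Y∈ z z∈Y in
        x , (r , there r∈ps , x≡r) , Px≐z
    ; disjoint  = R.disjoint
    }
    where module R = Refinement R
  ... | R | no fresh = record
    { ζ′        = dim S.Y
    ; ζ⊆ζ′      = incl (_⊆ᶻ_.include S.ζ⊆Y ∘ _⊆ᶻ_.include R.ζ⊆ζ′)
    -- `S.G` acts first and preserves windows, so `R.G` still moves the earlier cells into their
    -- pieces.
    ; G         = R.G ∘ᴷ S.G
    ; supported = λ t∉Y x i → trans (R.supported (t∉Y ∘ _⊆ᶻ_.include S.ζ⊆Y) (fun S.G x) i) (S.supported t∉Y x i)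
    ; window    = λ x → ≡⟨⟩-trans C {fun R.G (fun S.G x)} {fun S.G x} {x} (R.window (fun S.G x)) (S.window x)
    ; pieces    = S.Y ∷ R.pieces
    ; chosen    = S.Y∈𝒴 ∷ R.chosen
    ; dims      = λ where
        (here refl) → incl id
        (there m)   → incl (_⊆ᶻ_.include S.ζ⊆Y ∘ _⊆ᶻ_.include (R.dims m))
    ; lands     = λ where
        (here refl) → S.Y , here refl , S.lands
        {q} (there m) → let Y , Y∈ , land = R.lands m in
          Y , there Y∈ , λ x x≡q → land (fun S.G x) (≡⟨⟩-trans C {fun S.G x} {x} {q} (S.window x) x≡q)
    ; within    = λ where
        (here refl) z z∈Y → let x , x≡p , PGx≐z = S.within z z∈Y in
          fun R.G x , (p , here refl , ≡⟨⟩-trans C {fun R.G x} {x} {p} (R.window x) x≡p) , PGx≐z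
        (there m) z z∈Y → let x , (q , q∈ps , x≡q) , Px≐z = R.within m z z∈Y in
          x , (q , there q∈ps , x≡q) , Px≐z
    ; disjoint  = All.tabulate (λ {Z} Z∈ z z∈Y z∈Z →
        let x , x≡p , PGx≐z = S.within z z∈Y
            x′ , (q , q∈ps , x′≡q) , Px′≐z = R.within Z∈ z z∈Z
            -- A common point has only one `P`-preimage, so `p` and `q` would have the same window,
            -- against `fresh`.
            Gx≐x′ = fun-injective P {fun R.G x} {x′} (λ t i → trans (PGx≐z t i) (sym (Px′≐z t i)))
        in fresh (q , q∈ps , ≡⟨⟩-trans C {p} {x} {q} (≡⟨⟩-sym C {x} {p} x≡p)
             (≡⟨⟩-trans C {x} {x′} {q}
               (≡⟨⟩-trans C {x} {fun R.G x} {x′} (≡⟨⟩-sym C {fun R.G x} {x} (R.window x))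
                   (λ t {i} _ → Gx≐x′ t i)) x′≡q))) ∷ R.disjoint
    }
    where
    module R = Refinement R
    module S = CellRefinement (refine-cell R.ζ′ (P ∘ᴷ R.G)
      (λ t∉ζ′ x i → trans (P-supp (t∉ζ′ ∘ _⊆ᶻ_.include R.ζ⊆ζ′) (fun R.G x) i) (R.supported t∉ζ′ x i))
      C (λ m → _⊆ᶻ_.include R.ζ⊆ζ′ (C⊆ζ m)) 𝒴 dense p)

  -- Stages of the construction and the step between them.

  record Stage (n : ℕ) : Set₂ where
    field
      ζ         : Ξ
      P         : Keeping
      supported : Supported ζ P
      E         : Enumeration (Ξ.nodes ζ)
      C         : List Bit
      C⊆ζ       : ∀ {t i} → (t , i) ∈ₗ C → Ξ.nodes ζ t
      -- Later maps fix the window, so a bit visible in it can be recovered from the limit; this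
      -- gives injectivity.
      visible   : ∀ {t i} → (t , i) ∈ₗ bits E n → i < width C t
      -- Moving the argument within its cell leaves the values on these bits unchanged; this gives
      -- convergence.
      modulated : ∀ u v → u ≡⟨ C ⟩ v → fun P u ≡[ bits E n ] fun P v

  record Link (𝒴 : Pred IPS 2ℓ) {n} (S : Stage n) (S′ : Stage (suc n)) : Set₂ where
    private
      module S = Stage S
      module S′ = Stage S′
    field
      ps         : List Pt
      ps-cover   : ∀ x → ∃ λ p → p ∈ₗ ps × x ≡⟨ S.C ⟩ p
      refinement : Refinement S.ζ S.P S.C 𝒴 ps
    module R = Refinement refinement
    field
      P′≐PG      : ∀ x → fun S′.P x ≐ fun S.P (fun R.G x)
      Rζ′⊆ζ′     : R.ζ′ ⊆ᶻ S′.ζ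
      E⊆E′       : ∀ {k b} → b ∈ₗ bits S.E k → b ∈ₗ bits S′.E k
      window-mono : ∀ x y → x ≡⟨ S′.C ⟩ y → x ≡⟨ S.C ⟩ y

  module _ (n : ℕ) (ζ : Ξ) (P : Keeping) (supp : Supported ζ P) (E : Enumeration (Ξ.nodes ζ))
           (C₀ : List Bit) (C₀⊆ζ : ∀ {t i} → (t , i) ∈ₗ C₀ → Ξ.nodes ζ t) where
    private
      modulation : ∃ λ C → (∀ {t i} → (t , i) ∈ₗ C → Ξ.nodes ζ t) ×
                   (∀ x y → x ≡[ C ] y → fun P x ≡[ bits E n ] fun P y)
      modulation = modulus-list idᴷ P {ζ} (bits E n) (inside E)

      B : List Bit
      B = proj₁ modulation

      C⊆ζ : ∀ t {i} → (t , i) ∈ₗ bits E n ⊎ (t , i) ∈ₗ (B ++ C₀) → Ξ.nodes ζ t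
      C⊆ζ t (inj₁ m) = inside E m
      C⊆ζ t (inj₂ m) with ∈-++⁻ B m
      ... | inj₁ m′ = proj₁ (proj₂ modulation) m′
      ... | inj₂ m′ = C₀⊆ζ m′

    make-stage : Stage n
    make-stage = record
      { ζ         = ζ
      ; P         = P
      ; supported = supp
      ; E         = E
      -- Three demands are joined: visibility of the current bits, the modulus of `P` for them, and
      -- the previous window.
      ; C         = bits E n ++ (B ++ C₀)
      ; C⊆ζ       = λ {t} m → C⊆ζ t (∈-++⁻ (bits E n) m)
      ; visible   = λ m → width-∈ (∈-++⁺ˡ m)
      ; modulated = λ u v e → proj₂ (proj₂ modulation) u v λ {t} m → e t (width-∈ (∈-++⁺ʳ (bits E n) (∈-++⁺ˡ m)))
      }

    make-stage-window : ∀ x y → x ≡⟨ Stage.C make-stage ⟩ y → x ≡⟨ C₀ ⟩ y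
    make-stage-window x y e t i< = e t (≤-trans i< (≤-trans (width-++ B C₀ t) (width-++ (bits E n) (B ++ C₀) t)))

  -- The stages of `E` are retained, so that the diagonal stages over growing dimensions increase.
  _⊕_ : ∀ {A B : Pred T 1ℓ} → Enumeration A → Enumeration B → (∀ {t} → A t → B t) → Enumeration B
  _⊕_ {A} {B} E F A⊆B = record
    { bits       = λ k → bits E k ++ bits F k
    ; monotone   = λ {j} {k} j≤k m → mono j≤k (∈-++⁻ (bits E j) m)
    ; inside     = λ {k} {t} m → ins k t (∈-++⁻ (bits E k) m)
    ; exhaustive = λ t∈B i → let k , s , s≈t , m = exhaustive F t∈B i in k , s , s≈t , ∈-++⁺ʳ (bits E k) m
    }
    where
    mono : ∀ {j k b} → j ≤ k → b ∈ₗ bits E j ⊎ b ∈ₗ bits F j → b ∈ₗ bits E k ++ bits F k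
    mono j≤k (inj₁ m) = ∈-++⁺ˡ (monotone E j≤k m)
    mono {k = k} j≤k (inj₂ m) = ∈-++⁺ʳ (bits E k) (monotone F j≤k m)
    ins : ∀ k t {i} → (t , i) ∈ₗ bits E k ⊎ (t , i) ∈ₗ bits F k → B t
    ins k t (inj₁ m) = A⊆B (inside E m)
    ins k t (inj₂ m) = inside F m

  module _ (𝒴 : Pred IPS 2ℓ) (dense : Dense 𝒴) {n} (S : Stage n) where
    private
      module S = Stage S

      cover : ∃ λ ps → ∀ x → ∃ λ p → p ∈ₗ ps × x ≡[ closure S.C ] p
      cover = finite-cover (closure S.C)

      R : Refinement S.ζ S.P S.C 𝒴 (proj₁ cover)
      R = refine-cells S.ζ S.P S.supported S.C S.C⊆ζ 𝒴 dense (proj₁ cover)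

      module R = Refinement R

      supported′ : Supported R.ζ′ (S.P ∘ᴷ R.G)
      supported′ t∉ζ′ x i =
        trans (S.supported (t∉ζ′ ∘ _⊆ᶻ_.include R.ζ⊆ζ′) (fun R.G x) i) (R.supported t∉ζ′ x i)

      E′ : Enumeration (Ξ.nodes R.ζ′)
      E′ = (S.E ⊕ enumerate R.ζ′) (_⊆ᶻ_.include R.ζ⊆ζ′)

      C⊆ζ′ : ∀ {t i} → (t , i) ∈ₗ S.C → Ξ.nodes R.ζ′ t
      C⊆ζ′ m = _⊆ᶻ_.include R.ζ⊆ζ′ (S.C⊆ζ m)

    next : Stage (suc n)
    next = make-stage (suc n) R.ζ′ (S.P ∘ᴷ R.G) supported′ E′ S.C C⊆ζ′

    link : Link 𝒴 S next
    link = record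
      { ps          = proj₁ cover
      ; ps-cover    = λ x → let p , p∈ps , x≡p = proj₂ cover x in p , p∈ps , closure-width S.C x p x≡p
      ; refinement  = R
      ; P′≐PG       = λ _ _ _ → refl
      ; Rζ′⊆ζ′      = incl id
      ; E⊆E′        = ∈-++⁺ˡ
      ; window-mono = make-stage-window (suc n) R.ζ′ (S.P ∘ᴷ R.G) supported′ E′ S.C C⊆ζ′
      }

  -- The limit map, its image and the pieces.

  module FusionSequence (𝒴 : ℕ → Pred IPS 2ℓ) (S : ∀ n → Stage n) (L : ∀ n → Link (𝒴 n) (S n) (S (suc n))) where
    module S n = Stage (S n)
    module L n = Link (L n)

    ζ-mono : ∀ {j k} → j ≤′ k → ∀ {t} → Ξ.nodes (S.ζ j) t → Ξ.nodes (S.ζ k) t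
    ζ-mono (≤′-reflexive refl) t∈ζ = t∈ζ
    ζ-mono {k = suc k} (≤′-step p) t∈ζ =
      _⊆ᶻ_.include (L.Rζ′⊆ζ′ k) (_⊆ᶻ_.include (L.R.ζ⊆ζ′ k) (ζ-mono p t∈ζ))

    E-mono : ∀ {j k} → j ≤′ k → ∀ {n b} → b ∈ₗ bits (S.E j) n → b ∈ₗ bits (S.E k) n
    E-mono (≤′-reflexive refl) m = m
    E-mono {k = suc k} (≤′-step p) m = L.E⊆E′ k (E-mono p m)

    window-mono : ∀ {j k} → j ≤′ k → ∀ x y → x ≡⟨ S.C k ⟩ y → x ≡⟨ S.C j ⟩ y
    window-mono (≤′-reflexive refl) x y e = e
    window-mono {k = suc k} (≤′-step p) x y e = window-mono p x y (L.window-mono k x y e)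

    union : Pred T 1ℓ
    union t = ∃ λ n → Ξ.nodes (S.ζ n) t

    -- The least level depends neither on the membership proof nor on the representative of the
    -- node. Paired with the code at that level, it injects the union of the dimensions into the
    -- naturals.
    entry : ∀ {t} → t ∈ union → ∃ (Least (λ n → Ξ.nodes (S.ζ n) t))
    entry {t} (n , t∈ζ) = least (λ n → Ξ.nodes (S.ζ n) t) n t∈ζ

    code : ∀ n {t} → Ξ.nodes (S.ζ n) t → ℕ
    code n {t} t∈ζ = Injection.to (Ξ.countable (S.ζ n)) (t , t∈ζ)

    code-cong : ∀ {m n s t} (s∈ζ : Ξ.nodes (S.ζ m) s) (t∈ζ : Ξ.nodes (S.ζ n) t) → m ≡ n → s ≈ᵀ t →
                pair m (code m s∈ζ) ≡ pair n (code n t∈ζ)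
    code-cong {m} {s = s} {t} s∈ζ t∈ζ refl s≈t =
      cong (pair m) (Injection.cong (Ξ.countable (S.ζ m)) {s , s∈ζ} {t , t∈ζ} s≈t)

    code-injective : ∀ {m n s t} (s∈ζ : Ξ.nodes (S.ζ m) s) (t∈ζ : Ξ.nodes (S.ζ n) t) → m ≡ n →
                     code m s∈ζ ≡ code n t∈ζ → s ≈ᵀ t
    code-injective {m} {s = s} {t} s∈ζ t∈ζ refl = Injection.injective (Ξ.countable (S.ζ m)) {s , s∈ζ} {t , t∈ζ}

    ξ : Ξ
    ξ = record
      { nodes     = union
      ; respects  = λ {s} {t} s≈t (n , s∈ζ) → n , Ξ.respects (S.ζ n) {s} {t} s≈t s∈ζ
      ; countable = record
        { to        = λ (t , t∈ξ) → let n , t∈ζ , _ = entry t∈ξ in pair n (code n t∈ζ)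
        ; cong      = λ {(s , s∈ξ)} {(t , t∈ξ)} s≈t →
            let m , s∈ζ , m-least = entry s∈ξ ; n , t∈ζ , n-least = entry t∈ξ in
            code-cong s∈ζ t∈ζ
              (≤-antisym (m-least (Ξ.respects (S.ζ n) {t} {s} (Tᵉ.sym {s} {t} s≈t) t∈ζ))
                         (n-least (Ξ.respects (S.ζ m) {s} {t} s≈t s∈ζ)))
              s≈t
        ; injective = λ {(s , s∈ξ)} {(t , t∈ξ)} e →
            let m , s∈ζ , _ = entry s∈ξ ; n , t∈ζ , _ = entry t∈ξ
                m≡n , codes≡ = pair-injective {m} {code m s∈ζ} {n} {code n t∈ζ} e
            in code-injective s∈ζ t∈ζ m≡n codes≡
        }
      ; closed    = λ s⊂t (n , t∈ζ) → n , Ξ.closed (S.ζ n) s⊂t t∈ζ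
      }

    E∞ : Enumeration (Ξ.nodes ξ)
    E∞ = record
      { bits       = λ n → bits (S.E n) n
      ; monotone   = λ {j} {k} j≤k m → E-mono (≤⇒≤′ j≤k) (monotone (S.E j) j≤k m)
      ; inside     = λ {n} m → n , inside (S.E n) m
      ; exhaustive = λ (n , t∈ζ) i → let k , s , s≈t , m = exhaustive (S.E n) t∈ζ i in
          n ⊔ k , s , s≈t ,
          E-mono (≤⇒≤′ (m≤m⊔n n k)) (monotone (S.E n) (m≤n⊔m n k) m)
      }

    -- Here `u` is what the refining maps of the levels from `j` up to below `k` make of `x`, the
    -- last of them acting first. Each preserves its own window, hence also the coarser one of stage
    -- `j`.
    tail : ∀ {j k} → j ≤′ k → ∀ x → ∃ λ u → fun (S.P k) x ≐ fun (S.P j) u × u ≡⟨ S.C j ⟩ x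
    tail (≤′-reflexive refl) x = x , (λ _ _ → refl) , λ _ _ → refl
    tail {j} {suc k} (≤′-step p) x =
      let Gx = fun (L.R.G k) x
          u , Px≐Pu , u≡Gx = tail p Gx
      in u , (λ t i → trans (L.P′≐PG k x t i) (Px≐Pu t i)) ,
         ≡⟨⟩-trans (S.C j) {u} {Gx} {x} u≡Gx (window-mono p Gx x (L.R.window k x))

    coherent : ∀ x {j k} → j ≤ k → fun (S.P j) x ≡[ bits E∞ j ] fun (S.P k) x
    coherent x {j} j≤k {t} {i} m = let u , Px≐Pu , u≡x = tail (≤⇒≤′ j≤k) x in
      trans (sym (S.modulated j u x u≡x m)) (sym (Px≐Pu t i))

    limits : ∀ x → ∃ λ y → (∀ {j k} → j ≤ k → y ≡[ bits E∞ j ] fun (S.P k) x) ×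
                           (∀ {t} → ¬ Ξ.nodes ξ t → ∀ i → at y t i ≡ at x t i)
    limits x = limit (λ {s} {t} → Ξ.respects ξ {s} {t}) E∞ (λ k → fun (S.P k) x) (coherent x) x

    P∞ : Pt → Pt
    P∞ x = proj₁ (limits x)

    P∞-outside : ∀ {t} → ¬ Ξ.nodes ξ t → ∀ x i → at (P∞ x) t i ≡ at x t i
    P∞-outside t∉ξ x = proj₂ (proj₂ (limits x)) t∉ξ

    -- The level depends on the bits and not on `x`: convergence is uniform, so `keep→` and
    -- continuity carry over to the limit.
    approximates : ∀ B → ∃ λ k → ∀ {m} → k ≤ m → ∀ x → P∞ x ≡[ B ] fun (S.P m) x
    approximates [] = 0 , λ _ _ ()
    approximates ((t , i) ∷ B) with em {P = Ξ.nodes ξ t} | approximates B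
    ... | no t∉ξ | k , approx = k , λ where
      k≤m x (there b)     → approx k≤m x b
      {m} _ x (here refl) → trans (P∞-outside t∉ξ x i) (sym (S.supported m (λ t∈ζ → t∉ξ (m , t∈ζ)) x i))
    ... | yes t∈ξ | k , approx with exhaustive E∞ t∈ξ i
    ... | j , s , s≈t , s∈V = j ⊔ k , λ where
      ≤m x (there b) → approx (≤-trans (m≤n⊔m j k) ≤m) x b
      {m} ≤m x (here refl) → trans (sym (at-cong (P∞ x) s≈t i))
        (trans (proj₁ (proj₂ (limits x)) (≤-trans (m≤m⊔n j k) ≤m) s∈V) (at-cong (fun (S.P m) x) s≈t i))

    P∞ᴷ : Keeping
    P∞ᴷ = record
      { fun   = P∞
      ; keep→ = λ t {x} {y} e {s} s⊑t i → let k , approx = approximates ((s , i) ∷ []) in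
          trans (approx ≤-refl x (here refl)) (trans (keep→ (S.P k) t {x} {y} e s⊑t i) (sym (approx ≤-refl y (here refl))))
      ; keep← = λ t {x} {y} e {s} s⊑t i → injective x y t e s⊑t i em
      ; cont  = λ x t i →
          let k , approx = approximates ((t , i) ∷ [])
              B , P-cont = cont (S.P k) x t i
          in B , λ y e → trans (approx ≤-refl x (here refl)) (trans (P-cont y e) (sym (approx ≤-refl y (here refl))))
      }
      where
      injective : ∀ x y t → P∞ x ≡≤[ t ] P∞ y → ∀ {s} → s ⊑ t → ∀ i → Dec (Ξ.nodes ξ s) → at x s i ≡ at y s i
      injective x y t e s⊑t i (no s∉ξ) =
        trans (sym (P∞-outside s∉ξ x i)) (trans (e s⊑t i) (P∞-outside s∉ξ y i))
      -- Stage `n` sees the bit, and the bits `B` of a value of its map determine it. At stage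
      -- `n ⊔ k` the values on `B` are those of the limit, and `tail` writes them as values of the
      -- `n`-th map at `u` and `v`, which share the windows of `x` and `y`.
      injective x y t e {s} s⊑t i (yes s∈ξ) with exhaustive E∞ s∈ξ i
      ... | n , r , r≈s , r∈V with modulus (S.P n) idᴷ s i
      ... | B , B⊑s , mod with approximates B
      ... | k , approx with tail (≤⇒≤′ (m≤m⊔n n k)) x | tail (≤⇒≤′ (m≤m⊔n n k)) y
      ... | u , Px≐Pu , u≡x | v , Py≐Pv , v≡y =
        trans (sym (u≡x s i<)) (trans (mod u v (λ {q} {j} b →
          trans (sym (Px≐Pu q j)) (trans (sym (approx (m≤n⊔m n k) x b)) (trans (e (⊑-trans {q} {s} {t} (B⊑s b) s⊑t) j)
            (trans (approx (m≤n⊔m n k) y b) (Py≐Pv q j)))))) (v≡y s i<))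
        where
        i< : i < width (S.C n) s
        i< = subst (i <_) (width-cong (S.C n) {r} {s} r≈s) (S.visible n r∈V)

    fused : IPS
    fused = imageᴵ ξ P∞ᴷ

    -- P∞ x is a limit of P_k-values on the window cell of x, and Y is closed.
    P∞-in : ∀ k x Y → (∀ u → u ≡⟨ S.C k ⟩ x → fun (S.P k) u ∈↑ Y) → P∞ x ∈↑ Y
    P∞-in k x Y cell = closed Y (P∞ x) λ B →
      let m , approx = approximates B
          u , Px≐Pu , u≡x = tail (≤⇒≤′ (m≤m⊔n k m)) x
      in fun (S.P (k ⊔ m)) x ,
         ∈↑-cong Y {fun (S.P k) u} {fun (S.P (k ⊔ m)) x} (λ t i → sym (Px≐Pu t i)) (cell u u≡x) ,
         λ b → sym (approx (m≤n⊔m k m) x b)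

    fused-⊑fd : ∀ k → fused ⊑fd⋃ 𝒴 k
    fused-⊑fd k = record
      { pieces   = R.pieces
      ; chosen   = R.chosen
      ; below    = λ Y Y∈ → below Y∈
      ; covers   = λ z (x , P∞x≈z) →
          let p , p∈ps , x≡p = L.ps-cover k x
              Y , Y∈ , land = R.lands p∈ps
          in Y , Y∈ , IPS.respects Y
               {restrict (dim Y) (P∞ x)} {_↾_ {dim Y} {ξ} z (below Y∈)}
               (λ (t , t∈Y) i → P∞x≈z (t , _⊆ᶻ_.include (below Y∈) t∈Y) i)
               -- Stage `suc k` is taken because its map includes the refinement that moves the
               -- cells of window `k` into the pieces.
               (P∞-in (suc k) x Y λ u u≡x →
                 let u≡p = ≡⟨⟩-trans (S.C k) {u} {x} {p} (L.window-mono k u x u≡x) x≡p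
                 in ∈↑-cong Y {fun (S.P k) (fun R.G u)} {fun (S.P (suc k)) u}
                      (λ t i → sym (L.P′≐PG k u t i)) (land u u≡p))
      ; disjoint = λ Y Z Y∈ Z∈ Y≉Z {z} (z∈Y , z∈Z) → apart R.disjoint Y∈ Z∈ Y≉Z (extend ξ z zeros)
          (extend-∈ Y z (below Y∈) z∈Y) (extend-∈ Z z (below Z∈) z∈Z)
      }
      where
      module R = L.R k
      below : ∀ {Y} → Y ∈ₗ R.pieces → dim Y ⊆ᶻ ξ
      below Y∈ = incl λ t∈Y → suc k , _⊆ᶻ_.include (L.Rζ′⊆ζ′ k) (_⊆ᶻ_.include (R.dims Y∈) t∈Y)
      extend-∈ : ∀ Y z (Y⊆ξ : dim Y ⊆ᶻ ξ) → (_↾_ {dim Y} {ξ} z Y⊆ξ) ∈ set Y → extend ξ z zeros ∈↑ Y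
      extend-∈ Y z Y⊆ξ = IPS.respects Y {_↾_ {dim Y} {ξ} z Y⊆ξ} {restrict (dim Y) (extend ξ z zeros)}
        λ (t , t∈Y) i → sym (extend-in ξ z zeros (_⊆ᶻ_.include Y⊆ξ t∈Y) i)
      apart : ∀ {Ys Y Z} → AllPairs (λ Y Z → ∀ z → z ∈↑ Y → ¬ (z ∈↑ Z)) Ys → Y ∈ₗ Ys → Z ∈ₗ Ys → ¬ (Y ≈ᴵ Z) →
              ∀ z → z ∈↑ Y → ¬ (z ∈↑ Z)
      -- Disjointness is recorded for different positions of the list; equal positions are excluded
      -- by reflexivity of `≈ᴵ`.
      apart {Y = Y} _ (here refl) (here refl) Y≉Y = ⊥-elim (Y≉Y (≼-refl , ≼-refl))
        where
        ≼-refl : Y ≼ Y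
        ≼-refl = incl id , λ {y} (x , x∈Y , x≈y) → IPS.respects Y {x} {y} x≈y x∈Y
      apart (ds ∷ _) (here refl) (there m)   _   = All.lookup ds m
      apart (ds ∷ _) (there m)   (here refl) _   = λ z z∈Y z∈Z → All.lookup ds m z z∈Z z∈Y
      apart (_ ∷ ap) (there m)   (there n)   Y≉Z = apart ap m n Y≉Z

    -- The first map takes values in `X` on every cell, so the closedness argument applies at level
    -- 0.
    fused-≼ : ∀ X → dim X ⊆ᶻ S.ζ 0 → (∀ x → fun (S.P 0) x ∈↑ X) → fused ≼ X
    fused-≼ X X⊆ζ₀ P₀-in = X⊆ξ , λ {y} (z , (x , P∞x≈z) , z≈y) →
      IPS.respects X {restrict (dim X) (P∞ x)} {y}
        (λ (t , t∈X) i → trans (P∞x≈z (t , _⊆ᶻ_.include X⊆ξ t∈X) i) (z≈y (t , t∈X) i))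
        (P∞-in 0 x X λ u _ → P₀-in u)
      where
      X⊆ξ : dim X ⊆ᶻ ξ
      X⊆ξ = incl λ t∈X → 0 , _⊆ᶻ_.include X⊆ζ₀ t∈X

  -- Assembling the sequence below a given `X`.

  module _ (𝒴 : ℕ → Pred IPS 2ℓ) (dense : ∀ k → Dense (𝒴 k)) (X : IPS) where

    stages : ∀ n → Stage n
    -- The start is the parametrisation of `X`, with no earlier window to respect.
    stages zero    = make-stage 0 (dim X) (parametrisation X) (parametrisation-supported X) (enumerate (dim X)) [] λ ()
    stages (suc n) = next (𝒴 n) (dense n) (stages n)

    links : ∀ n → Link (𝒴 n) (stages n) (stages (suc n))
    links n = link (𝒴 n) (dense n) (stages n)

    open FusionSequence 𝒴 stages links

    fusion : ∃ λ Z → (∀ k → Z ⊑fd⋃ 𝒴 k) × Z ≼ X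
    fusion = fused , fused-⊑fd , fused-≼ X (incl id) (parametrisation-in X)

theorem4p25 : (∀ {ℓ} → ExcludedMiddle ℓ) →
    V=L →
    (𝒴 : ℕ → Pred IPS 2ℓ) →
    (∀ k → 𝒴 k Respects _≈ᴵ_) →
    (∀ k → Dense (𝒴 k)) →
    Dense (λ X → ∀ k → X ⊑fd⋃ 𝒴 k)
theorem4p25 em _ 𝒴 _ dense = Fusion.fusion em 𝒴 dense
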